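{- There exists a covering system of the integers such that all moduli are odd, greater than $1$, and pairwise distinct, except that $11$ is used exactly seven times as a modulus.
   Context: A covering system of the integers is a finite collection of congruences $x\equiv r_j \pmod{m_j}$ such that every integer satisfies at least one of them. "$11$ is used exactly seven times as a modulus" means exactly seven congruences of the system have modulus $11$, while all other moduli are distinct from each other and from $11$. -}

module Defs where

open import Data.Nat using (ℕ; _<_; _≟_)
open import Data.Nat.Divisibility using () renaming (_∣_ to _∣ℕ_)
open import Data.Integer using (ℤ; +_; _-_)
open import Data.Integer.Divisibility using (_∣_)
open import Data.Product using (_×_; _,_; proj₁; proj₂)
open import Data.List using (List; map; filter; length)
open import Data.List.Relation.Unary.All using (All)
open import Data.List.Relation.Unary.Any using (Any)
open import Data.List.Relation.Unary.Unique.Propositional using (Unique)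
open import Relation.Nullary using (¬_)
open import Relation.Nullary.Decidable using (¬?)
open import Relation.Binary.PropositionalEquality using (_≡_)

Congruence : Set
Congruence = ℕ × ℤ

modulus : Congruence → ℕ
modulus = proj₁

residue : Congruence → ℤ
residue = proj₂

Satisfies : ℤ → Congruence → Set
Satisfies x c = (+ modulus c) ∣ (x - residue c)

CoveringSystem : List Congruence → Set
CoveringSystem S = (x : ℤ) → Any (Satisfies x) S

moduli : List Congruence → List ℕ
moduli S = map modulus S

OddAboveOne : ℕ → Set
OddAboveOne m = (1 < m) × ¬ (2 ∣ℕ m)

ElevenSevenTimesOthersDistinct : List Congruence → Set
ElevenSevenTimesOthersDistinct S =
  (length (filter (_≟ 11) (moduli S)) ≡ 7) ×
  Unique (filter (λ m → ¬? (m ≟ 11)) (moduli S))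

{-# OPTIONS --safe #-}
module Submission where

-- The congruences mod 11 leave four classes. For p = 3, 5, 7 keep one class of each
-- level p^i to be split at the next level; then every d yields congruences mod d p^i
-- for all i. A class mod 11 * 3^j is met by the moduli 3^j and 11 * 3^j, one mod
-- 11 * 3^j * 5^i by the four moduli 5^i times a divisor of 11 * 3^j (of the powers of 3
-- only 1 and 3^j), and so on, and these are shared by the four classes. With 3, 5 and 7
-- exactly four classes remain for every (j, i, k), each met by 16 moduli times 13, 17,
-- 19 or 23: the prime 13 disposes of all but 1/13 of two of them, 17 of a third, 19 of the
-- fourth, and 23 of the rest. The levels are cut off at bounded depth, and the
-- classes left at the ends of the chains have so many divisors that multiples of 121
-- and of a few primes from 29 on cover them. The resulting system is checked by a
-- verified search through residue classes.

-- Why four classes remain. Four residues mod 11 and two digits in base 3 (the third is kept) give 8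
-- classes; 3^j takes 4 and 11 * 3^j takes one, so 3 remain. Four digits in base 5 make 12; the two
-- moduli without 11 take 3 each, the two with 11 take one each, and 4 remain, two of them with the
-- same residue mod 11. Six digits in base 7 make 24, of which the eight moduli take 4 + 4 + 3 + 3 +
-- 2 + 2 + 1 + 1 = 20. The four survivors form two pairs, each agreeing mod 11 and in the digit in
-- base 5. Of the 16 moduli times a new prime, two meet all survivors, six (without 7, but with 5 or
-- 11) meet a pair, and eight a single class. So both members of a pair can lose 2 + 6 + 4 = 12 = 13
-- - 1 subclasses, and one class can lose 2 + 6 + 8 = 16 = 17 - 1: hence the roles of 13 and 17. The
-- moduli include 3^19, 5^12 and 7^6, so the period exceeds 10^22 and its residues cannot be
-- enumerated. The check follows instead a tree of classes, and a branch ends as soon as one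
-- congruence contains its class.

open import Defs
open import Data.Bool using (Bool; true; false; T; _∧_; _∨_; if_then_else_)
open import Data.Bool.ListAction using (any)
open import Data.Bool.Properties using (T-∧; T-∨; T-≡)
open import Data.Integer using (ℤ; +_; _-_; ∣_∣) renaming (_+_ to _⊕_; _*_ to _⊛_)
import Data.Integer.Divisibility.Signed as Signed
open import Data.Integer.DivMod using (_%ℕ_; _/ℕ_; n%ℕd<d; a≡a%ℕn+[a/ℕn]*n)
import Data.Integer.Properties as ℤ
open import Data.Integer.Tactic.RingSolver using (solve-∀)
open import Data.List using (List; []; _∷_; _++_; concat; filter; foldr; length; map)
open import Data.List.Relation.Unary.All using (All; all?)
import Data.List.Relation.Unary.AllPairs as AllPairs
open import Data.List.Relation.Unary.Any as Any using (Any)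
open import Data.List.Relation.Unary.Any.Properties using (any⁻; map⁺; map⁻; filter⁻; ++⁻)
open import Data.List.Relation.Unary.Linked using (Linked; linked?)
open import Data.List.Relation.Unary.Linked.Properties using (Linked⇒AllPairs)
open import Data.List.Relation.Unary.Unique.Propositional using (Unique)
open import Data.Nat
  using (ℕ; zero; suc; NonZero; _+_; _*_; _∸_; _/_; _<_; _≟_; _<ᵇ_; _<?_; s≤s⁻¹)
open import Data.Nat.Divisibility using (_∣_; _∣?_)
import Data.Nat.Properties as ℕ
open import Data.Product using (Σ; _×_; _,_; proj₁; proj₂)
open import Data.Sum using (inj₁; inj₂; [_,_]′)
open import Function using (_∘_; Equivalence)
open import Relation.Binary.PropositionalEquality
  using (_≡_; refl; sym; cong; cong₂; subst; module ≡-Reasoning)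
open import Relation.Nullary using (Dec; yes; no; does; ¬?; _×-dec_)

-- Residue classes and the congruences still to be used on them

-- A congruence x ≡ r (mod m), written (m , r), during the search of a class
-- s mod n: m = known * rest, where known divides n and rest has yet to be split off.
record Pending : Set where
  constructor pending
  field
    congr : ℕ × ℕ
    known : ℕ
    rest  : ℕ

open Pending

toCongruence : ℕ × ℕ → Congruence
toCongruence (m , r) = m , + r

-- Only `congr` enters: `known` and `rest` are bookkeeping without meaning for soundness, so no
-- invariant about them has to be maintained in the proofs.
Solves : ℤ → Pending → Set
Solves x = Satisfies x ∘ toCongruence ∘ congr

-- The class is parametrized by y rather than described by a divisibility condition, so splitting it
-- amounts to a substitution for y.
Covered : (n s : ℕ) → List Pending → Set
Covered n s is = ∀ y → Any (Solves (+ s ⊕ + n ⊛ y)) is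

-- Classes contained in one congruence, and division of a class into subclasses

holds : ∀ {P : Set} (P? : Dec P) → T (does P?) → P
holds (yes p) _ = p

-- The test for the whole class s mod n to lie in r mod m. That m divides n is tested afresh
-- although the bookkeeping would imply it: this is what frees soundness from any invariant linking
-- `known`, `rest` and n. The absolute value allows s < r.
solvedBy : ℕ → ℕ → Pending → Bool
solvedBy n s (pending (m , r) _ _) = does (m ∣? n) ∧ does (m ∣? ∣ + s - + r ∣)

-- Both summands of (s - r) + n y are multiples of m. The detour through signed divisibility gives
-- access to the rules for sums and multiples over the integers.
solvedBy-sound : ∀ n s i → T (solvedBy n s i) → ∀ y → Solves (+ s ⊕ + n ⊛ y) i
solvedBy-sound n s (pending (m , r) _ _) h y = Signed.∣⇒∣ᵤ (subst (+ m Signed.∣_)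
  (rearrange (+ s) (+ n) y (+ r)) (Signed.∣m∣n⇒∣m+n m∣s-r (Signed.∣m⇒∣m*n y m∣n)))
  where
  both = Equivalence.to (T-∧ {does (m ∣? n)}) h
  m∣n : + m Signed.∣ + n
  m∣n = Signed.∣ᵤ⇒∣ (holds (m ∣? n) (proj₁ both))
  m∣s-r : + m Signed.∣ (+ s - + r)
  m∣s-r = Signed.∣ᵤ⇒∣ (holds (m ∣? ∣ + s - + r ∣) (proj₂ both))
  rearrange : ∀ s n y r → (s - r) ⊕ n ⊛ y ≡ (s ⊕ n ⊛ y) - r
  rearrange = solve-∀

-- Division with remainder, y = t + z p, puts s + n y into the subclass of t. The remainder is a
-- natural number below p for negative y too, so finitely many t suffice.
covered-by-subclasses : ∀ p .{{_ : NonZero p}} n s is →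
  (∀ t → t < p → Covered (n * p) (s + n * t) is) → Covered n s is
covered-by-subclasses p n s is h y =
  subst (λ x → Any (Solves x) is) reassemble (h t (n%ℕd<d y p) z)
  where
  t = y %ℕ p
  z = y /ℕ p
  ring : ∀ s n t p z → (s ⊕ n ⊛ t) ⊕ (n ⊛ p) ⊛ z ≡ s ⊕ n ⊛ (t ⊕ z ⊛ p)
  ring = solve-∀
  open ≡-Reasoning
  reassemble : + (s + n * t) ⊕ + (n * p) ⊛ z ≡ + s ⊕ + n ⊛ y
  reassemble = begin
    + (s + n * t) ⊕ + (n * p) ⊛ z
      -- The embedding of ℕ into ℤ commutes with sums by computation, but with products only by a
      -- lemma; both products are moved across it before the ring solver applies.
      ≡⟨ cong₂ (λ a b → (+ s ⊕ a) ⊕ b ⊛ z) (ℤ.pos-* n t) (ℤ.pos-* n p) ⟩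
    (+ s ⊕ + n ⊛ + t) ⊕ (+ n ⊛ + p) ⊛ z
      ≡⟨ ring (+ s) (+ n) (+ t) (+ p) z ⟩
    + s ⊕ + n ⊛ (+ t ⊕ z ⊛ + p)
      ≡⟨ cong (λ y → + s ⊕ + n ⊛ y) (sym (a≡a%ℕn+[a/ℕn]*n y p)) ⟩
    + s ⊕ + n ⊛ y ∎

-- Bookkeeping of a split

start : ℕ × ℕ → Pending
start c = pending c 1 (proj₁ c)

-- Applied only where p divides `rest`, so the quotient is exact and `known` times `rest` stays
-- equal to the modulus.
advance : (p : ℕ) .{{_ : NonZero p}} → Pending → Pending
advance p (pending c g d) = pending c (g * p) (d / p)

-- As all proposed splits are at primes, `known` is gcd(m, n). By the Chinese remainder theorem r
-- mod m meets s mod n exactly when this gcd divides s - r, so a congruence that fails here is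
-- useless for the whole subtree.
compatible? : ∀ s i → Dec (known i ∣ ∣ + s - + proj₂ (congr i) ∣)
compatible? s i = known i ∣? ∣ + s - + proj₂ (congr i) ∣

-- The search and its soundness

-- The class s mod n is searched to depth f, by splitting it into p subclasses, where
-- p is proposed by the parameter. Only solvedBy has to be trusted: dropping
-- congruences or splitting at a useless p can make the search fail, but not lie.
module Search (propose : List Pending → ℕ) where

  cover      : (f n s : ℕ) → List Pending → Bool
  -- The proposal arrives as an argument so that a case distinction can make it nonzero; a proposal
  -- of 0 counts as failure, like exhausted depth.
  splitInto  : (f n s : ℕ) → List Pending → ℕ → Bool
  -- The three lists depend on p but not on the subclass, so they are formed once per split. `final`
  -- holds the congruences whose modulus becomes completely known, the only ones that can newly
  -- contain a subclass. They occur in `active` as well, but when none contains the subclass all of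
  -- them fail `compatible?` there, because `known` has become the full modulus.
  subclasses : (f n s n′ : ℕ) (final active idle : List Pending) → ℕ → Bool
  subclass   : (f n′ : ℕ) (final active idle : List Pending) → ℕ → Bool

  cover zero    n s is = false
  cover (suc f) n s is = splitInto f n s is (propose is)

  splitInto f n s is zero      = false
  splitInto f n s is p@(suc _) = subclasses f n s (n * p)
    (map (advance p) (filter (λ i → rest i ≟ p) is))
    (map (advance p) (filter (λ i → p ∣? rest i) is))
    (filter (λ i → ¬? (p ∣? rest i)) is) p

  subclasses f n s n′ final active idle zero    = true
  subclasses f n s n′ final active idle (suc t) =
    subclass f n′ final active idle (s + n * t) ∧ subclasses f n s n′ final active idle t

  subclass f n′ final active idle s′ =
    -- Recursion happens only if no single congruence settles the subclass. `idle` needs no new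
    -- filtering: its `known` is unchanged and divides n, hence divides the shift from s to s′.
    any (solvedBy n′ s′) final ∨ cover f n′ s′ (filter (compatible? s′) active ++ idle)

  -- Soundness at depth f is taken as a hypothesis, which leaves the induction on f to `cover-sound`
  -- alone.
  splitInto-sound : ∀ f → (∀ n s is → T (cover f n s is) → Covered n s is) →
                    ∀ n s is p → T (splitInto f n s is p) → Covered n s is
  splitInto-sound f ih n s is p@(suc _) h = covered-by-subclasses p n s is (below p h)
    where
    final  = map (advance p) (filter (λ i → rest i ≟ p) is)
    active = map (advance p) (filter (λ i → p ∣? rest i) is)
    idle   = filter (λ i → ¬? (p ∣? rest i)) is

    below : ∀ k → T (subclasses f n s (n * p) final active idle k) →
            ∀ t → t < k → Covered (n * p) (s + n * t) is
    below (suc k) h t t<1+k z with Equivalence.to T-∧ h | t ≟ k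
    ... | h₁ , h₂ | no t≢k = below k h₂ t (ℕ.≤∧≢⇒< (s≤s⁻¹ t<1+k) t≢k) z
    ... | h₁ , h₂ | yes refl with Equivalence.to T-∨ h₁
    -- A congruence found in a sublist is also in the full list, and `advance` does not change
    -- `congr`, so a solution passes back through `map⁻` and `filter⁻` as it is. No property of the
    -- filters is used.
    ...   | inj₁ solved = filter⁻ (λ i → rest i ≟ p)
            (map⁻ (Any.map (λ {i} q → solvedBy-sound _ _ i q z) (any⁻ _ final solved)))
    -- A witness from deeper in the tree lies in one of the two parts of the appended list, and each
    -- part is traced back separately.
    ...   | inj₂ deeper =
            [ filter⁻ (λ i → p ∣? rest i) ∘ map⁻ ∘ filter⁻ (compatible? (s + n * t))
            , filter⁻ (λ i → ¬? (p ∣? rest i))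
            ]′ (++⁻ _ (ih _ _ _ deeper z))

  cover-sound : ∀ f n s is → T (cover f n s is) → Covered n s is
  cover-sound (suc f) n s is = splitInto-sound f (cover-sound f) n s is (propose is)

-- Choosing the prime for the next split

-- The heuristic maximizes c - p, where c counts the congruences that lack only the
-- prime p, so that few subclasses remain; 60 keeps the truncated subtraction exact.
gain : ℕ → ℕ → ℕ
gain p zero      = 0
gain p c@(suc _) = c + 60 ∸ p

-- A modulus with a prime factor outside this list could never become completely known. The largest
-- entry lies below 60, as `gain` requires.
primes : List ℕ
primes = 3 ∷ 5 ∷ 7 ∷ 11 ∷ 13 ∷ 17 ∷ 19 ∷ 23 ∷ 29 ∷ 31 ∷ 37 ∷ 41 ∷ []

-- Ties go to the first argument, so under `foldr` the smaller prime wins. In particular 3 is chosen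
-- when no congruence lacks only one prime, and the initial pair (0 , 0) is never the result.
better : ℕ × ℕ → ℕ × ℕ → ℕ × ℕ
better a@(k , _) b@(l , _) = if k <ᵇ l then b else a

bestPrime : List ℕ → ℕ
bestPrime ds = proj₂ (foldr (λ p → better (gain p (length (filter (_≟ p) ds)) , p)) (0 , 0) primes)

-- Only values of `rest` that are primes of the list influence the choice. Discarding those from 60
-- on leaves the answer unchanged and shortens the list that is scanned once for every prime.
propose : List Pending → ℕ
propose is = bestPrime (filter (_<? 60) (map rest is))

open Search propose

-- From a successful search to a covering system

-- The root of the tree is the class 0 mod 1, that is, all integers. The hypothesis is an equation
-- between booleans so that `refl` discharges it by running the search on a closed term.
covering : ∀ f cs → cover f 1 0 (map start cs) ≡ true → CoveringSystem (map toCongruence cs)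
covering f cs found x = map⁺ (map⁻ (subst (λ y → Any (Solves y) (map start cs)) (0+1*x≡x x)
  (cover-sound f 1 0 (map start cs) (Equivalence.from T-≡ found) x)))
  where
  0+1*x≡x : ∀ x → + 0 ⊕ + 1 ⊛ x ≡ x
  0+1*x≡x = solve-∀

-- Distinct and odd moduli

decided : ∀ {P : Set} (P? : Dec P) → does P? ≡ true → P
decided P? eq = holds P? (Equivalence.from T-≡ eq)

-- For a list of several thousand moduli this replaces a quadratic number of comparisons by one
-- comparison per neighbouring pair; transitivity supplies the rest.
ascending⇒unique : ∀ {ms} → Linked _<_ ms → Unique ms
ascending⇒unique = AllPairs.map ℕ.<⇒≢ ∘ Linked⇒AllPairs ℕ.<-trans

oddAboveOne? : ∀ m → Dec (OddAboveOne m)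
oddAboveOne? m = (1 <? m) ×-dec ¬? (2 ∣? m)

-- The congruences, by increasing modulus

infixr 5 _mod_∷_
_mod_∷_ : ℕ → ℕ → List (ℕ × ℕ) → List (ℕ × ℕ)
r mod m ∷ cs = (m , r) ∷ cs

-- For p = 3, 5, 7 the class kept at every level is that of -1. Accordingly p^i carries the residue
-- p^(i-1) - 1: all digits in base p are p - 1 except the leading one, which is 0. The leading
-- digits 1 to p - 2 are left to products with other moduli, and the digit p - 1 leads to the next
-- level.
table₀ : List (ℕ × ℕ)
table₀ = concat (
  -- The seven residues 0 to 6 mod 11 are spent here and in the next row; everything else is aimed
  -- at 7, 8, 9 and 10 mod 11.
  (0 mod 3 ∷ 0 mod 5 ∷ 0 mod 7 ∷ 2 mod 9 ∷ 0 mod 11 ∷ 1 mod 11 ∷ 2 mod 11 ∷ 3 mod 11 ∷ []) ∷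
  (4 mod 11 ∷ 5 mod 11 ∷ 6 mod 11 ∷ 0 mod 13 ∷ 1 mod 15 ∷ 0 mod 17 ∷ 0 mod 19 ∷ 1 mod 21 ∷ []) ∷
  -- `7 mod 33` disposes of 7 mod 11 inside 1 mod 3. Inside 1 mod 3 and 3 mod 5, `8 mod 55` and
  -- `163 mod 165` dispose of 8 and 9 mod 11. With 0 and 1 mod 5 already gone, this leaves 8, 9, 10
  -- mod 11 at 2 mod 5 and 10 mod 11 at 3 mod 5; the higher levels repeat the pattern with shifted
  -- digits.
  (0 mod 23 ∷ 4 mod 25 ∷ 8 mod 27 ∷ 0 mod 29 ∷ 0 mod 31 ∷ 7 mod 33 ∷ 2 mod 35 ∷ 0 mod 37 ∷ []) ∷
  (28 mod 39 ∷ 0 mod 41 ∷ 41 mod 45 ∷ 6 mod 49 ∷ 19 mod 51 ∷ 8 mod 55 ∷ 40 mod 57 ∷ []) ∷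
  -- `32 mod 77` and `208 mod 231` remove 10 mod 11 at the digits 4 and 5 in base 7; `382 mod 385`
  -- and `712 mod 1155` do so for 8 mod 11 at 2 mod 5. As `2 mod 35` and `52 mod 105` act only at 2
  -- mod 5, the survivors are 9 mod 11, 2 mod 5 with 4 or 5 mod 7, and 10 mod 11, 3 mod 5 with 2 or
  -- 3 mod 7.
  (50 mod 63 ∷ 17 mod 65 ∷ 25 mod 69 ∷ 34 mod 75 ∷ 32 mod 77 ∷ 26 mod 81 ∷ 38 mod 85 ∷ []) ∷
  -- 13 serves the pair with 9 mod 11, hence `60 mod 91` is 4 mod 7. By contrast `59 mod 87` and
  -- `32 mod 93` are -1 mod 3: 29 and 31 act here on the kept class and help at the ends of the
  -- chains.
  (59 mod 87 ∷ 60 mod 91 ∷ 32 mod 93 ∷ 23 mod 95 ∷ 95 mod 99 ∷ 52 mod 105 ∷ 41 mod 111 ∷ []) ∷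
  -- `93 mod 119` is 2 mod 7 and `122 mod 133` is 3 mod 7: 17 and 19 serve one member each of the
  -- pair with 10 mod 11. `10 mod 121` begins the supply for the ends of the chains; `263 mod 363`,
  -- `604 mod 605` and `692 mod 847` are likewise 10 mod 11, and -1 mod 3, 5 and 7 respectively.
  (27 mod 115 ∷ 41 mod 117 ∷ 93 mod 119 ∷ 10 mod 121 ∷ 4 mod 123 ∷ 24 mod 125 ∷ 122 mod 133 ∷ []) ∷
  (71 mod 135 ∷ 53 mod 143 ∷ 89 mod 145 ∷ 13 mod 147 ∷ 104 mod 153 ∷ 64 mod 155 ∷ 39 mod 161 ∷ []) ∷
  (163 mod 165 ∷ 59 mod 171 ∷ 114 mod 175 ∷ 4 mod 185 ∷ 120 mod 187 ∷ 71 mod 189 ∷ []) ∷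
  (97 mod 195 ∷ 202 mod 203 ∷ 169 mod 205 ∷ 140 mod 207 ∷ 153 mod 209 ∷ 202 mod 217 ∷ []) ∷
  -- The 16 multiples of 17 aimed at 10 mod 11, 3 mod 5, 2 mod 7 use up the residues 0 to 15 mod 17;
  -- `118 mod 221` starts on the remaining residue 16 mod 17.
  (118 mod 221 ∷ 59 mod 225 ∷ 208 mod 231 ∷ 80 mod 243 ∷ 167 mod 245 ∷ 92 mod 247 ∷ []) ∷
  (185 mod 253 ∷ 193 mod 255 ∷ 223 mod 259 ∷ 206 mod 261 ∷ 88 mod 273 ∷ 19 mod 275 ∷ []) ∷
  -- Both classes served by 13 lose the residues 0 to 11 mod 13. `77 mod 299` is 12 mod 13, so the
  -- products 13 * 23 work together with 23 on the residue that is left.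
  (35 mod 279 ∷ 253 mod 285 ∷ 83 mod 287 ∷ 260 mod 297 ∷ 77 mod 299 ∷ 122 mod 315 ∷ []) ∷
  (295 mod 319 ∷ 246 mod 323 ∷ 264 mod 325 ∷ 197 mod 333 ∷ 96 mod 341 ∷ 48 mod 343 ∷ []) ∷
  (52 mod 345 ∷ 314 mod 351 ∷ 163 mod 357 ∷ 263 mod 363 ∷ 332 mod 369 ∷ 49 mod 375 ∷ []) ∷
  (382 mod 385 ∷ 10 mod 399 ∷ 296 mod 405 ∷ 230 mod 407 ∷ 344 mod 425 ∷ 328 mod 429 ∷ []) ∷
  (149 mod 435 ∷ 356 mod 441 ∷ 98 mod 451 ∷ 47 mod 455 ∷ 206 mod 459 ∷ 284 mod 465 ∷ []) ∷
  (194 mod 475 ∷ 340 mod 483 ∷ 383 mod 495 ∷ 287 mod 513 ∷ 514 mod 525 ∷ 230 mod 539 ∷ []) ∷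
  (79 mod 555 ∷ 241 mod 561 ∷ 134 mod 567 ∷ 464 mod 575 ∷ 32 mod 585 ∷ 233 mod 595 ∷ []) ∷
  (604 mod 605 ∷ 461 mod 609 ∷ 334 mod 615 ∷ 71 mod 621 ∷ 124 mod 625 ∷ 307 mod 627 ∷ []) ∷
  (34 mod 637 ∷ 545 mod 651 ∷ 628 mod 663 ∷ 563 mod 665 ∷ 584 mod 675 ∷ 131 mod 693 ∷ []) ∷
  (317 mod 715 ∷ 499 mod 725 ∷ 242 mod 729 ∷ 517 mod 735 ∷ 472 mod 741 ∷ 394 mod 759 ∷ []) ∷
  (23 mod 765 ∷ 149 mod 775 ∷ 671 mod 777 ∷ 674 mod 783 ∷ 802 mod 805 ∷ 725 mod 819 ∷ []) ∷
  (394 mod 825 ∷ 314 mod 833 ∷ 206 mod 837 ∷ 692 mod 847 ∷ 158 mod 855 ∷ 622 mod 861 ∷ []) ∷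
  (324 mod 875 ∷ 458 mod 891 ∷ 493 mod 897 ∷ 172 mod 899 ∷ 844 mod 925 ∷ 27 mod 931 ∷ []) ∷
  (923 mod 935 ∷ 17 mod 945 ∷ 878 mod 957 ∷ 265 mod 969 ∷ 214 mod 975 ∷ 17 mod 999 ∷ []) ∷
  (438 mod 1001 ∷ 839 mod 1015 ∷ 503 mod 1023 ∷ 889 mod 1025 ∷ 97 mod 1029 ∷ 167 mod 1035 ∷ []) ∷
  (43 mod 1045 ∷ 782 mod 1053 ∷ 401 mod 1071 ∷ 804 mod 1085 ∷ 395 mod 1089 ∷ 968 mod 1105 ∷ []) ∷
  (989 mod 1107 ∷ 1049 mod 1125 ∷ 867 mod 1127 ∷ 802 mod 1147 ∷ 712 mod 1155 ∷ 941 mod 1197 ∷ []) ∷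
  (161 mod 1215 ∷ 494 mod 1221 ∷ 314 mod 1225 ∷ 643 mod 1235 ∷ 97 mod 1265 ∷ 244 mod 1275 ∷ []) ∷
  (185 mod 1287 ∷ 524 mod 1295 ∷ 764 mod 1305 ∷ 604 mod 1309 ∷ 503 mod 1323 ∷ 316 mod 1353 ∷ []) ∷
  (712 mod 1365 ∷ 349 mod 1375 ∷ 53 mod 1377 ∷ 134 mod 1395 ∷ 1175 mod 1421 ∷ 994 mod 1425 ∷ []) ∷
  (664 mod 1435 ∷ 662 mod 1449 ∷ 1396 mod 1463 ∷ 1043 mod 1485 ∷ 12 mod 1495 ∷ 881 mod 1519 ∷ []) ∷
  (458 mod 1539 ∷ 1206 mod 1547 ∷ 689 mod 1575 ∷ 9 mod 1595 ∷ 1253 mod 1615 ∷ 1462 mod 1617 ∷ []) ∷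
  (199 mod 1625 ∷ 68 mod 1665 ∷ 428 mod 1683 ∷ 890 mod 1701 ∷ 1339 mod 1705 ∷ 832 mod 1715 ∷ []) ∷
  (1639 mod 1725 ∷ 738 mod 1729 ∷ 422 mod 1755 ∷ 592 mod 1771 ∷ 898 mod 1785 ∷ 1371 mod 1813 ∷ []) ∷
  (1319 mod 1815 ∷ 1763 mod 1827 ∷ 908 mod 1845 ∷ 1106 mod 1863 ∷ 874 mod 1875 ∷ []) ∷
  (725 mod 1881 ∷ 1063 mod 1911 ∷ 1614 mod 1925 ∷ 1259 mod 1953 ∷ 1733 mod 1989 ∷ []) ∷
  (1648 mod 1995 ∷ 1273 mod 2009 ∷ 134 mod 2025 ∷ 802 mod 2035 ∷ 1286 mod 2079 ∷ []) ∷
  (1741 mod 2093 ∷ 599 mod 2125 ∷ 592 mod 2145 ∷ 824 mod 2175 ∷ 728 mod 2187 ∷ 1742 mod 2205 ∷ []) ∷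
  (2201 mod 2223 ∷ 20 mod 2233 ∷ 1834 mod 2255 ∷ 1291 mod 2261 ∷ 1139 mod 2275 ∷ []) ∷
  (2165 mod 2277 ∷ 1043 mod 2295 ∷ 1049 mod 2325 ∷ 314 mod 2331 ∷ 1700 mod 2349 ∷ []) ∷
  (99 mod 2375 ∷ 734 mod 2387 ∷ 342 mod 2401 ∷ 1747 mod 2415 ∷ 1121 mod 2431 ∷ 179 mod 2457 ∷ []) ∷
  (1769 mod 2475 ∷ 265 mod 2499 ∷ 323 mod 2511 ∷ 923 mod 2541 ∷ 1583 mod 2565 ∷ []) ∷
  (1196 mod 2583 ∷ 199 mod 2625 ∷ 161 mod 2673 ∷ 194 mod 2691 ∷ 2582 mod 2695 ∷ []) ∷
  (1013 mod 2697 ∷ 263 mod 2717 ∷ 919 mod 2775 ∷ 2575 mod 2793 ∷ 2353 mod 2805 ∷ []) ∷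
  (1592 mod 2835 ∷ 2155 mod 2849 ∷ 1637 mod 2871 ∷ 2074 mod 2875 ∷ 2849 mod 2907 ∷ []) ∷
  (2489 mod 2925 ∷ 2494 mod 2975 ∷ 1285 mod 3003 ∷ 824 mod 3025 ∷ 314 mod 3045 ∷ []) ∷
  (2582 mod 3069 ∷ 2614 mod 3075 ∷ 2498 mod 3087 ∷ 2582 mod 3105 ∷ 624 mod 3125 ∷ []) ∷
  (1033 mod 3135 ∷ 1616 mod 3157 ∷ 1133 mod 3159 ∷ 1217 mod 3185 ∷ 44 mod 3213 ∷ []) ∷
  (2834 mod 3255 ∷ 890 mod 3267 ∷ 1780 mod 3289 ∷ 2413 mod 3315 ∷ 1494 mod 3325 ∷ []) ∷
  (1799 mod 3375 ∷ 1651 mod 3381 ∷ 275 mod 3441 ∷ 3407 mod 3465 ∷ 2760 mod 3509 ∷ []) ∷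
  (417 mod 3553 ∷ 889 mod 3575 ∷ 1340 mod 3591 ∷ 1374 mod 3625 ∷ 3401 mod 3645 ∷ []) ∷
  (428 mod 3663 ∷ 664 mod 3675 ∷ 73 mod 3705 ∷ 1616 mod 3773 ∷ 2077 mod 3795 ∷ 1094 mod 3825 ∷ []) ∷
  (1043 mod 3861 ∷ 1999 mod 3875 ∷ 2449 mod 3885 ∷ 1349 mod 3915 ∷ 2221 mod 3927 ∷ []) ∷
  (944 mod 3969 ∷ 3539 mod 4025 ∷ 1484 mod 4059 ∷ 257 mod 4095 ∷ 724 mod 4125 ∷ []) ∷
  (2348 mod 4131 ∷ 3548 mod 4165 ∷ 854 mod 4185 ∷ 644 mod 4199 ∷ 769 mod 4235 ∷ 881 mod 4263 ∷ []) ∷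
  (2894 mod 4275 ∷ 3289 mod 4305 ∷ 179 mod 4347 ∷ 2249 mod 4375 ∷ 3013 mod 4389 ∷ []) ∷
  (53 mod 4455 ∷ 3674 mod 4459 ∷ 727 mod 4485 ∷ 2347 mod 4495 ∷ 1861 mod 4557 ∷ []) ∷
  (4049 mod 4617 ∷ 2872 mod 4641 ∷ 468 mod 4655 ∷ 2419 mod 4675 ∷ 4364 mod 4725 ∷ []) ∷
  (449 mod 4785 ∷ 1918 mod 4845 ∷ 923 mod 4851 ∷ 4699 mod 4875 ∷ 1097 mod 4995 ∷ []) ∷
  (152 mod 5005 ∷ 989 mod 5049 ∷ 2624 mod 5075 ∷ 4859 mod 5103 ∷ 2054 mod 5115 ∷ []) ∷
  (2849 mod 5125 ∷ 1567 mod 5145 ∷ 4514 mod 5175 ∷ 4861 mod 5187 ∷ 2969 mod 5225 ∷ []) ∷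
  (1592 mod 5265 ∷ 1054 mod 5313 ∷ 5063 mod 5355 ∷ 4199 mod 5425 ∷ 4409 mod 5439 ∷ []) ∷
  (3959 mod 5445 ∷ 944 mod 5481 ∷ 2294 mod 5525 ∷ 5093 mod 5535 ∷ 2348 mod 5589 ∷ []) ∷
  (1499 mod 5625 ∷ 3562 mod 5635 ∷ 98 mod 5643 ∷ 5522 mod 5733 ∷ 4987 mod 5735 ∷ []) ∷
  (4639 mod 5775 ∷ 1861 mod 5831 ∷ 2771 mod 5859 ∷ 5389 mod 5929 ∷ 1070 mod 5967 ∷ []) ∷
  (4973 mod 5985 ∷ 3331 mod 6027 ∷ 2834 mod 6075 ∷ 692 mod 6105 ∷ 5949 mod 6125 ∷ []) ∷
  (2619 mod 6175 ∷ 4751 mod 6237 ∷ 3652 mod 6279 ∷ 3681 mod 6293 ∷ 3639 mod 6325 ∷ []) ∷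
  (5599 mod 6375 ∷ 3452 mod 6435 ∷ 69 mod 6475 ∷ 1224 mod 6517 ∷ 5849 mod 6525 ∷ []) ∷
  (3838 mod 6545 ∷ 2186 mod 6561 ∷ 5417 mod 6615 ∷ 719 mod 6669 ∷ 251 mod 6699 ∷ []) ∷
  (2164 mod 6765 ∷ 1879 mod 6783 ∷ 439 mod 6825 ∷ 5201 mod 6831 ∷ 6124 mod 6875 ∷ []) ∷
  (4103 mod 6885 ∷ 6974 mod 6975 ∷ 5606 mod 6993 ∷ 867 mod 7007 ∷ 1214 mod 7047 ∷ []) ∷
  (3429 mod 7105 ∷ 1849 mod 7125 ∷ 6509 mod 7161 ∷ 1714 mod 7175 ∷ 685 mod 7203 ∷ []) ∷
  (2552 mod 7245 ∷ 6544 mod 7293 ∷ 6093 mod 7315 ∷ 3455 mod 7371 ∷ 3419 mod 7425 ∷ []) ∷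
  (6889 mod 7475 ∷ 1931 mod 7497 ∷ 728 mod 7533 ∷ 3429 mod 7595 ∷ 4388 mod 7623 ∷ []) ∷
  (3293 mod 7695 ∷ 3905 mod 7749 ∷ 1949 mod 7875 ∷ 7790 mod 7889 ∷ 7324 mod 7975 ∷ []) ∷
  (1943 mod 8019 ∷ 3282 mod 8029 ∷ 1988 mod 8073 ∷ 6744 mod 8075 ∷ 2197 mod 8085 ∷ []) ∷
  (5885 mod 8091 ∷ 4749 mod 8125 ∷ 6115 mod 8151 ∷ 3506 mod 8379 ∷ 1418 mod 8415 ∷ []) ∷
  (647 mod 8505 ∷ 1174 mod 8525 ∷ 3233 mod 8547 ∷ 489 mod 8575 ∷ 8369 mod 8613 ∷ []) ∷
  (949 mod 8625 ∷ 2278 mod 8645 ∷ 1880 mod 8721 ∷ 6389 mod 8775 ∷ 3287 mod 8855 ∷ []) ∷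
  (1969 mod 8925 ∷ 284 mod 9009 ∷ 8819 mod 9065 ∷ 6599 mod 9075 ∷ 8567 mod 9135 ∷ []) ∷
  (1539 mod 9163 ∷ 7235 mod 9207 ∷ 3527 mod 9261 ∷ 3617 mod 9315 ∷ 1249 mod 9375 ∷ []) ∷
  (8348 mod 9405 ∷ 5200 mod 9471 ∷ 8504 mod 9477 ∷ 7342 mod 9555 ∷ 74 mod 9625 ∷ []) ∷
  (5399 mod 9639 ∷ 3464 mod 9765 ∷ 3563 mod 9801 ∷ 9073 mod 9867 ∷ 5421 mod 9889 ∷ []) ∷
  (203 mod 9945 ∷ 9603 mod 9947 ∷ 3244 mod 9975 ∷ 7104 mod 10045 ∷ 7424 mod 10125 ∷ []) ∷
  (7286 mod 10143 ∷ 10119 mod 10175 ∷ 2232 mod 10241 ∷ 6506 mod 10323 ∷ 1097 mod 10395 ∷ []) ∷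
  (1377 mod 10465 ∷ 6995 mod 10527 ∷ 6124 mod 10625 ∷ 1028 mod 10633 ∷ 3343 mod 10659 ∷ []) ∷
  (8314 mod 10725 ∷ 6128 mod 10773 ∷ 7615 mod 10829 ∷ 6749 mod 10875 ∷ 5831 mod 10935 ∷ []) ∷
  (3662 mod 10989 ∷ 9239 mod 11025 ∷ 2543 mod 11115 ∷ 10954 mod 11165 ∷ 4914 mod 11275 ∷ []) ∷
  (283 mod 11305 ∷ 10240 mod 11319 ∷ 4324 mod 11375 ∷ 8402 mod 11385 ∷ 7469 mod 11475 ∷ []) ∷
  (3617 mod 11583 ∷ 6374 mod 11625 ∷ 10688 mod 11655 ∷ 2429 mod 11745 ∷ 7457 mod 11781 ∷ []) ∷
  (6749 mod 11875 ∷ 6236 mod 11907 ∷ 5354 mod 11935 ∷ 10632 mod 12005 ∷ 1264 mod 12075 ∷ []) ∷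
  (3702 mod 12103 ∷ 2243 mod 12155 ∷ 6038 mod 12177 ∷ 2987 mod 12285 ∷ 6224 mod 12375 ∷ []) ∷
  (9233 mod 12393 ∷ 4640 mod 12397 ∷ 5998 mod 12495 ∷ 9719 mod 12555 ∷ 8719 mod 12597 ∷ []) ∷
  (12427 mod 12617 ∷ 10289 mod 12691 ∷ 11549 mod 12705 ∷ 9260 mod 12789 ∷ 44 mod 12825 ∷ []) ∷
  (7433 mod 12915 ∷ 7424 mod 13041 ∷ 9124 mod 13125 ∷ 10328 mod 13167 ∷ 5993 mod 13365 ∷ []) ∷
  (244 mod 13377 ∷ 11192 mod 13455 ∷ 9589 mod 13475 ∷ 9452 mod 13485 ∷ 6533 mod 13585 ∷ []) ∷
  (4850 mod 13671 ∷ 5588 mod 13851 ∷ 10607 mod 13923 ∷ 223 mod 13965 ∷ 5719 mod 14025 ∷ []) ∷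
  (1028 mod 14063 ∷ 10664 mod 14175 ∷ 2617 mod 14245 ∷ 8864 mod 14355 ∷ 7249 mod 14375 ∷ []) ∷
  (3533 mod 14535 ∷ 9008 mod 14553 ∷ 3074 mod 14625 ∷ 2638 mod 14651 ∷ 7849 mod 14875 ∷ []) ∷
  (9007 mod 15015 ∷ 13749 mod 15125 ∷ 12770 mod 15147 ∷ 3499 mod 15225 ∷ 1457 mod 15309 ∷ []) ∷
  (10799 mod 15345 ∷ 349 mod 15375 ∷ 15287 mod 15435 ∷ 13139 mod 15525 ∷ 11777 mod 15561 ∷ []) ∷
  (3124 mod 15625 ∷ 97 mod 15631 ∷ 12319 mod 15675 ∷ 9589 mod 15785 ∷ 10367 mod 15795 ∷ []) ∷
  (9043 mod 15827 ∷ 5039 mod 15925 ∷ 13451 mod 15939 ∷ 6848 mod 16065 ∷ 349 mod 16275 ∷ []) ∷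
  (13229 mod 16317 ∷ 15254 mod 16335 ∷ 5669 mod 16443 ∷ 13077 mod 16445 ∷ 10369 mod 16575 ∷ []) ∷
  (9474 mod 16625 ∷ 15630 mod 16709 ∷ 485 mod 16767 ∷ 2400 mod 16807 ∷ 14624 mod 16875 ∷ []) ∷
  (2092 mod 16905 ∷ 3860 mod 16929 ∷ 8227 mod 17017 ∷ 13166 mod 17199 ∷ 3437 mod 17205 ∷ []) ∷
  (2714 mod 17325 ∷ 5977 mod 17493 ∷ 1429 mod 17545 ∷ 7181 mod 17577 ∷ 16928 mod 17765 ∷ []) ∷
  (5585 mod 17787 ∷ 7324 mod 17875 ∷ 16982 mod 17901 ∷ 14948 mod 17955 ∷ 6614 mod 18081 ∷ []) ∷
  (1874 mod 18125 ∷ 4859 mod 18225 ∷ 7952 mod 18315 ∷ 5074 mod 18375 ∷ 4519 mod 18525 ∷ []) ∷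
  (8909 mod 18711 ∷ 14117 mod 18837 ∷ 12592 mod 18865 ∷ 4493 mod 18879 ∷ 15739 mod 18975 ∷ []) ∷
  (1935 mod 19019 ∷ 14099 mod 19125 ∷ 12032 mod 19305 ∷ 5624 mod 19375 ∷ 14944 mod 19425 ∷ []) ∷
  (14944 mod 19551 ∷ 2564 mod 19575 ∷ 1528 mod 19635 ∷ 6560 mod 19683 ∷ 3212 mod 19845 ∷ []) ∷
  (18325 mod 19943 ∷ 9611 mod 20007 ∷ 19907 mod 20097 ∷ 13199 mod 20125 ∷ 6533 mod 20295 ∷ []) ∷
  (19967 mod 20349 ∷ 2714 mod 20475 ∷ 14309 mod 20493 ∷ 2374 mod 20625 ∷ 13283 mod 20655 ∷ []) ∷
  (13544 mod 20825 ∷ 5849 mod 20925 ∷ 20993 mod 20995 ∷ 19732 mod 21021 ∷ 2186 mod 21141 ∷ []) ∷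
  (20789 mod 21175 ∷ 5389 mod 21315 ∷ 20849 mod 21375 ∷ 8819 mod 21483 ∷ 12214 mod 21525 ∷ []) ∷
  (17492 mod 21609 ∷ 19457 mod 21735 ∷ 20624 mod 21875 ∷ 16268 mod 21879 ∷ 1858 mod 21945 ∷ []) ∷
  (5389 mod 22099 ∷ 13283 mod 22113 ∷ 944 mod 22275 ∷ 3037 mod 22295 ∷ 19564 mod 22425 ∷ []) ∷
  (6929 mod 22491 ∷ 6317 mod 22599 ∷ 7202 mod 22785 ∷ 20789 mod 22869 ∷ 7929 mod 23023 ∷ []) ∷
  (8423 mod 23085 ∷ 20019 mod 23275 ∷ 5224 mod 23375 ∷ 7199 mod 23625 ∷ 7447 mod 23667 ∷ []) ∷
  (19424 mod 23925 ∷ 23327 mod 24057 ∷ 10877 mod 24087 ∷ 15443 mod 24219 ∷ 5794 mod 24225 ∷ []) ∷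
  (4892 mod 24255 ∷ 13931 mod 24273 ∷ 22249 mod 24375 ∷ 3398 mod 24453 ∷ 1308 mod 24563 ∷ []) ∷
  (4938 mod 24871 ∷ 12164 mod 25025 ∷ 14678 mod 25137 ∷ 23858 mod 25245 ∷ 20999 mod 25375 ∷ []) ∷
  (6317 mod 25515 ∷ 7499 mod 25575 ∷ 4388 mod 25641 ∷ 20089 mod 25725 ∷ 12230 mod 25839 ∷ []) ∷
  (21074 mod 25875 ∷ 20233 mod 25935 ∷ 17599 mod 26125 ∷ 16415 mod 26163 ∷ 539 mod 26325 ∷ []) ∷
  (11318 mod 26411 ∷ 16844 mod 26775 ∷ 15299 mod 27027 ∷ 19074 mod 27125 ∷ 6859 mod 27195 ∷ []) ∷
  [])

table₁ : List (ℕ × ℕ)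
table₁ = concat (
  (15749 mod 27225 ∷ 25892 mod 27405 ∷ 12319 mod 27489 ∷ 22679 mod 27621 ∷ 19974 mod 27625 ∷ []) ∷
  (6722 mod 27945 ∷ 26249 mod 28125 ∷ 4689 mod 28175 ∷ 20888 mod 28215 ∷ 25640 mod 28413 ∷ []) ∷
  (21140 mod 28431 ∷ 13712 mod 28665 ∷ 23799 mod 28675 ∷ 6949 mod 28875 ∷ 11825 mod 28917 ∷ []) ∷
  (10093 mod 29155 ∷ 6047 mod 29295 ∷ 815 mod 29393 ∷ 16037 mod 29403 ∷ 12362 mod 29601 ∷ []) ∷
  (734 mod 29645 ∷ 2231 mod 29667 ∷ 13463 mod 29835 ∷ 5830 mod 29841 ∷ 26519 mod 29925 ∷ []) ∷
  (6859 mod 30135 ∷ 4049 mod 30375 ∷ 3905 mod 30429 ∷ 22219 mod 30525 ∷ 3499 mod 30625 ∷ []) ∷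
  (24331 mod 30723 ∷ 24849 mod 30875 ∷ 12707 mod 30969 ∷ 14957 mod 31185 ∷ 11318 mod 31213 ∷ []) ∷
  (20032 mod 31395 ∷ 29462 mod 31465 ∷ 8810 mod 31581 ∷ 8699 mod 31625 ∷ 499 mod 31875 ∷ []) ∷
  (27439 mod 31899 ∷ 17555 mod 31977 ∷ 4739 mod 32175 ∷ 31265 mod 32319 ∷ 20110 mod 32487 ∷ []) ∷
  (9113 mod 32585 ∷ 8249 mod 32625 ∷ 15619 mod 32725 ∷ 24056 mod 32805 ∷ 23939 mod 33075 ∷ []) ∷
  (9953 mod 33345 ∷ 5564 mod 33495 ∷ 30214 mod 33825 ∷ 12253 mod 33915 ∷ 6467 mod 33957 ∷ []) ∷
  (33199 mod 34125 ∷ 4607 mod 34155 ∷ 21249 mod 34375 ∷ 15119 mod 34425 ∷ 11339 mod 34749 ∷ []) ∷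
  (16124 mod 34875 ∷ 14867 mod 34965 ∷ 5872 mod 35035 ∷ 26972 mod 35235 ∷ 11384 mod 35343 ∷ []) ∷
  (14699 mod 35525 ∷ 6124 mod 35625 ∷ 18059 mod 35805 ∷ 2974 mod 35875 ∷ 3772 mod 36015 ∷ []) ∷
  (21389 mod 36225 ∷ 13012 mod 36309 ∷ 373 mod 36465 ∷ 9019 mod 36575 ∷ 23462 mod 36855 ∷ []) ∷
  (22724 mod 37125 ∷ 29888 mod 37179 ∷ 24583 mod 37191 ∷ 26324 mod 37375 ∷ 22658 mod 37485 ∷ []) ∷
  (29159 mod 37665 ∷ 29714 mod 37791 ∷ 7499 mod 37851 ∷ 23274 mod 37975 ∷ 20579 mod 38073 ∷ []) ∷
  (7664 mod 38115 ∷ 24695 mod 38367 ∷ 17144 mod 38475 ∷ 24128 mod 38745 ∷ 3077 mod 39123 ∷ []) ∷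
  (374 mod 39375 ∷ 22882 mod 39445 ∷ 19106 mod 39501 ∷ 11999 mod 39875 ∷ 23813 mod 40095 ∷ []) ∷
  (4703 mod 40131 ∷ 31772 mod 40145 ∷ 15677 mod 40365 ∷ 9974 mod 40375 ∷ 3814 mod 40425 ∷ []) ∷
  (16847 mod 40455 ∷ 11249 mod 40625 ∷ 36838 mod 40755 ∷ 1028 mod 40817 ∷ 7496 mod 41013 ∷ []) ∷
  (30183 mod 41503 ∷ 10205 mod 41553 ∷ 19889 mod 41769 ∷ 37463 mod 41895 ∷ 38444 mod 42075 ∷ []) ∷
  (38758 mod 42189 ∷ 29564 mod 42525 ∷ 18499 mod 42625 ∷ 33032 mod 42735 ∷ 33074 mod 42875 ∷ []) ∷
  (17279 mod 43065 ∷ 14749 mod 43125 ∷ 9194 mod 43225 ∷ 22913 mod 43605 ∷ 33263 mod 43659 ∷ []) ∷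
  (27449 mod 43875 ∷ 4549 mod 43953 ∷ 33172 mod 44051 ∷ 24539 mod 44275 ∷ 34099 mod 44625 ∷ []) ∷
  (44042 mod 45045 ∷ 3919 mod 45325 ∷ 19874 mod 45375 ∷ 32966 mod 45441 ∷ 42188 mod 45619 ∷ []) ∷
  (42839 mod 45675 ∷ 4773 mod 45815 ∷ 37178 mod 45927 ∷ 9314 mod 46035 ∷ 15179 mod 46189 ∷ []) ∷
  (10142 mod 46305 ∷ 39014 mod 46575 ∷ 32525 mod 46683 ∷ 21874 mod 46875 ∷ 46451 mod 46893 ∷ []) ∷
  (38444 mod 47025 ∷ 30379 mod 47355 ∷ 20897 mod 47385 ∷ 9631 mod 47481 ∷ 11164 mod 47775 ∷ []) ∷
  (2825 mod 47817 ∷ 11624 mod 48125 ∷ 12203 mod 48195 ∷ 23099 mod 48825 ∷ 2204 mod 48951 ∷ []) ∷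
  (36044 mod 49005 ∷ 10877 mod 49049 ∷ 17009 mod 49329 ∷ 13792 mod 49335 ∷ 19457 mod 49445 ∷ []) ∷
  (37994 mod 49725 ∷ 3772 mod 49735 ∷ 11224 mod 49875 ∷ 10240 mod 50127 ∷ 20089 mod 50225 ∷ []) ∷
  (45197 mod 50301 ∷ 4801 mod 50421 ∷ 3374 mod 50625 ∷ 7727 mod 50715 ∷ 49004 mod 50787 ∷ []) ∷
  (25948 mod 51205 ∷ 36098 mod 51597 ∷ 11312 mod 51615 ∷ 48914 mod 51975 ∷ 20214 mod 52325 ∷ []) ∷
  (35132 mod 52479 ∷ 40754 mod 52635 ∷ 51029 mod 52731 ∷ 33749 mod 53125 ∷ 14748 mod 53165 ∷ []) ∷
  (12748 mod 53295 ∷ 20138 mod 53361 ∷ 36199 mod 53625 ∷ 46817 mod 53703 ∷ 8963 mod 53865 ∷ []) ∷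
  (20726 mod 54243 ∷ 29374 mod 54375 ∷ 47384 mod 54675 ∷ 29312 mod 54945 ∷ 35699 mod 55125 ∷ []) ∷
  (8917 mod 55223 ∷ 29219 mod 55575 ∷ 6124 mod 55825 ∷ 2672 mod 56133 ∷ 32143 mod 56203 ∷ []) ∷
  (10724 mod 56375 ∷ 45512 mod 56511 ∷ 2544 mod 56525 ∷ 28762 mod 56595 ∷ 27026 mod 56637 ∷ []) ∷
  (31624 mod 56875 ∷ 22064 mod 56925 ∷ 51754 mod 57057 ∷ 39599 mod 57375 ∷ 57077 mod 57915 ∷ []) ∷
  (9374 mod 58125 ∷ 21461 mod 58653 ∷ 9314 mod 58725 ∷ 53888 mod 58905 ∷ 19682 mod 59049 ∷ []) ∷
  (39999 mod 59375 ∷ 16442 mod 59535 ∷ 42699 mod 59675 ∷ 19403 mod 59829 ∷ 56294 mod 60021 ∷ []) ∷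
  (27439 mod 60025 ∷ 12284 mod 60291 ∷ 35074 mod 60375 ∷ 20803 mod 60515 ∷ 53294 mod 60775 ∷ []) ∷
  (41678 mod 60885 ∷ 53882 mod 61047 ∷ 30014 mod 61425 ∷ 647 mod 61479 ∷ 16124 mod 61875 ∷ []) ∷
  (20168 mod 61965 ∷ 19732 mod 61985 ∷ 15994 mod 62475 ∷ 6074 mod 62775 ∷ 1138 mod 62985 ∷ []) ∷
  (33746 mod 63063 ∷ 59672 mod 63085 ∷ 26243 mod 63423 ∷ 41159 mod 63455 ∷ 30764 mod 63525 ∷ []) ∷
  (41012 mod 63945 ∷ 56474 mod 64125 ∷ 44736 mod 64141 ∷ 41390 mod 64449 ∷ 26702 mod 65205 ∷ []) ∷
  (14374 mod 65625 ∷ 23561 mod 65637 ∷ 31118 mod 65835 ∷ 66296 mod 66297 ∷ 42767 mod 66339 ∷ []) ∷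
  (38069 mod 66825 ∷ 44197 mod 66885 ∷ 56939 mod 67275 ∷ 4199 mod 67375 ∷ 21923 mod 67473 ∷ []) ∷
  (15308 mod 67797 ∷ 28269 mod 67925 ∷ 63062 mod 68355 ∷ 68606 mod 68607 ∷ 57979 mod 69069 ∷ []) ∷
  (47991 mod 69223 ∷ 23813 mod 69255 ∷ 52821 mod 69629 ∷ 61669 mod 69825 ∷ 50599 mod 70125 ∷ []) ∷
  (56594 mod 70315 ∷ 70199 mod 70875 ∷ 23225 mod 71001 ∷ 54669 mod 71225 ∷ 8084 mod 71687 ∷ []) ∷
  (17774 mod 71775 ∷ 33124 mod 71875 ∷ 63422 mod 72171 ∷ 70181 mod 72261 ∷ 55808 mod 72657 ∷ []) ∷
  (70394 mod 72675 ∷ 12977 mod 72765 ∷ 44468 mod 72819 ∷ 5999 mod 73125 ∷ 35762 mod 73255 ∷ []) ∷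
  (19700 mod 73359 ∷ 30953 mod 73689 ∷ 4874 mod 74375 ∷ 12004 mod 74431 ∷ 7864 mod 74613 ∷ []) ∷
  (66064 mod 75075 ∷ 23057 mod 75411 ∷ 20624 mod 75625 ∷ 15443 mod 75735 ∷ 41649 mod 75803 ∷ []) ∷
  (42874 mod 76125 ∷ 23327 mod 76545 ∷ 20699 mod 76725 ∷ 29609 mod 76923 ∷ 55889 mod 77517 ∷ []) ∷
  (3824 mod 77625 ∷ 11588 mod 77805 ∷ 15624 mod 78125 ∷ 61004 mod 78155 ∷ 21724 mod 78375 ∷ []) ∷
  (7694 mod 78489 ∷ 15399 mod 78925 ∷ 35639 mod 78975 ∷ 48733 mod 79135 ∷ 71686 mod 79233 ∷ []) ∷
  (40074 mod 79625 ∷ 61469 mod 80325 ∷ 6290 mod 81081 ∷ 20824 mod 81375 ∷ 11318 mod 81585 ∷ []) ∷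
  (33074 mod 81675 ∷ 58967 mod 82215 ∷ 39389 mod 82225 ∷ 76460 mod 82467 ∷ 15551 mod 82863 ∷ []) ∷
  (66724 mod 82875 ∷ 16124 mod 83125 ∷ 54438 mod 83545 ∷ 71927 mod 83835 ∷ 7202 mod 84035 ∷ []) ∷
  (44999 mod 84375 ∷ 42664 mod 84525 ∷ 2078 mod 84645 ∷ 36553 mod 84721 ∷ 52667 mod 85239 ∷ []) ∷
  (30617 mod 85293 ∷ 32822 mod 85995 ∷ 66424 mod 86025 ∷ 16574 mod 86625 ∷ 31103 mod 86751 ∷ []) ∷
  (82564 mod 86779 ∷ 66688 mod 87465 ∷ 18369 mod 87725 ∷ 66149 mod 87885 ∷ 84472 mod 88179 ∷ []) ∷
  (48113 mod 88209 ∷ 23526 mod 88319 ∷ 51830 mod 88803 ∷ 6269 mod 88825 ∷ 14405 mod 88837 ∷ []) ∷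
  (65414 mod 88935 ∷ 44801 mod 89001 ∷ 21624 mod 89375 ∷ 83078 mod 89505 ∷ 60710 mod 89523 ∷ []) ∷
  (36494 mod 89775 ∷ 26018 mod 90405 ∷ 9374 mod 90625 ∷ 85049 mod 91125 ∷ 24191 mod 91287 ∷ []) ∷
  (82249 mod 91875 ∷ 14090 mod 92169 ∷ 8224 mod 92625 ∷ 56537 mod 93555 ∷ 88150 mod 93639 ∷ []) ∷
  (30497 mod 94185 ∷ 65414 mod 94325 ∷ 12872 mod 94395 ∷ 30590 mod 94743 ∷ 65074 mod 94875 ∷ []) ∷
  (41513 mod 95095 ∷ 21749 mod 95625 ∷ 30869 mod 95697 ∷ 92168 mod 95931 ∷ 58364 mod 96525 ∷ []) ∷
  (40624 mod 96875 ∷ 42038 mod 96957 ∷ 74255 mod 97461 ∷ 88003 mod 97755 ∷ 7874 mod 97875 ∷ []) ∷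
  (32944 mod 98175 ∷ 13121 mod 98415 ∷ 36014 mod 98441 ∷ 6467 mod 99715 ∷ 98873 mod 100035 ∷ []) ∷
  (71882 mod 100485 ∷ 81624 mod 100625 ∷ 23558 mod 101745 ∷ 63062 mod 101871 ∷ []) ∷
  (55949 mod 102375 ∷ 61532 mod 102465 ∷ 67521 mod 102557 ∷ 93124 mod 103125 ∷ []) ∷
  (38069 mod 103275 ∷ 84349 mod 104125 ∷ 104003 mod 104247 ∷ 7199 mod 104625 ∷ []) ∷
  (16794 mod 104975 ∷ 94807 mod 105105 ∷ 37907 mod 105705 ∷ 17324 mod 105875 ∷ []) ∷
  (93851 mod 106029 ∷ 24499 mod 106575 ∷ 89249 mod 106875 ∷ 50399 mod 107415 ∷ []) ∷
  (10849 mod 107625 ∷ 63797 mod 108045 ∷ 45539 mod 108675 ∷ 25115 mod 108927 ∷ []) ∷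
  (24999 mod 109375 ∷ 24683 mod 109395 ∷ 80947 mod 109417 ∷ 107194 mod 109725 ∷ []) ∷
  (13474 mod 110495 ∷ 48032 mod 110565 ∷ 63307 mod 110789 ∷ 72224 mod 111375 ∷ []) ∷
  (16414 mod 111475 ∷ 17495 mod 111537 ∷ 111362 mod 111573 ∷ 91324 mod 112125 ∷ []) ∷
  (110123 mod 112455 ∷ 10934 mod 112995 ∷ 54908 mod 113373 ∷ 91385 mod 113553 ∷ []) ∷
  (57574 mod 113925 ∷ 40130 mod 114219 ∷ 62180 mod 115101 ∷ 15937 mod 115115 ∷ []) ∷
  (68444 mod 115425 ∷ 71224 mod 116375 ∷ 19249 mod 116875 ∷ 11318 mod 116963 ∷ []) ∷
  -- 7^6 is the last pure power of 7; beyond it the class of -1 has to be finished by products with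
  -- other primes.
  (68282 mod 117369 ∷ 16806 mod 117649 ∷ 92249 mod 118125 ∷ 38317 mod 118335 ∷ []) ∷
  (84941 mod 118503 ∷ 30106 mod 119119 ∷ 49124 mod 119625 ∷ 117368 mod 120285 ∷ []) ∷
  (18080 mod 120393 ∷ 8987 mod 120435 ∷ 29132 mod 121095 ∷ 97849 mod 121125 ∷ []) ∷
  (111614 mod 121275 ∷ 78137 mod 121365 ∷ 61249 mod 121875 ∷ 50423 mod 122265 ∷ []) ∷
  (63454 mod 122451 ∷ 97019 mod 122815 ∷ 6614 mod 123039 ∷ 85403 mod 124355 ∷ []) ∷
  (7202 mod 124509 ∷ 24056 mod 124659 ∷ 47199 mod 125125 ∷ 5966 mod 125307 ∷ []) ∷
  (107288 mod 125685 ∷ 94544 mod 126225 ∷ 27782 mod 126567 ∷ 100624 mod 126875 ∷ []) ∷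
  (1214 mod 127575 ∷ 127124 mod 127875 ∷ 103487 mod 128205 ∷ 112699 mod 128625 ∷ []) ∷
  (60992 mod 129195 ∷ 374 mod 129375 ∷ 35794 mod 129675 ∷ 12374 mod 130625 ∷ []) ∷
  (81053 mod 130815 ∷ 62369 mod 130977 ∷ 100574 mod 131625 ∷ 121757 mod 131859 ∷ []) ∷
  (44932 mod 132055 ∷ 48803 mod 132153 ∷ 105181 mod 133133 ∷ 48974 mod 133875 ∷ []) ∷
  (104102 mod 135135 ∷ 51624 mod 135625 ∷ 128869 mod 135975 ∷ 28124 mod 136125 ∷ []) ∷
  (2672 mod 136323 ∷ 3772 mod 136857 ∷ 53864 mod 137025 ∷ 15553 mod 137445 ∷ []) ∷
  (52487 mod 137781 ∷ 53864 mod 138105 ∷ 25499 mod 138125 ∷ 86239 mod 138567 ∷ []) ∷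
  (94324 mod 139601 ∷ 23489 mod 139725 ∷ 48086 mod 140049 ∷ 37499 mod 140625 ∷ []) ∷
  (64238 mod 140679 ∷ 10324 mod 140875 ∷ 116819 mod 141075 ∷ 130283 mod 142065 ∷ []) ∷
  (99872 mod 142155 ∷ 136247 mod 142443 ∷ 122639 mod 143325 ∷ 51699 mod 143375 ∷ []) ∷
  (18764 mod 143451 ∷ 18499 mod 144375 ∷ 76463 mod 144585 ∷ 132544 mod 145775 ∷ []) ∷
  (31499 mod 146475 ∷ 44954 mod 147015 ∷ 127840 mod 147147 ∷ 23813 mod 147987 ∷ []) ∷
  (96017 mod 148005 ∷ 24989 mod 148225 ∷ 124232 mod 148335 ∷ 120869 mod 149175 ∷ []) ∷
  (43217 mod 149205 ∷ 44474 mod 149625 ∷ 52478 mod 150381 ∷ 123724 mod 150675 ∷ []) ∷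
  (129032 mod 150903 ∷ 70874 mod 151875 ∷ 75347 mod 152145 ∷ 82862 mod 152361 ∷ []) ∷
  (83124 mod 153125 ∷ 58288 mod 153615 ∷ 74249 mod 154375 ∷ 75459 mod 154693 ∷ []) ∷
  (104894 mod 154791 ∷ 33632 mod 154845 ∷ 83564 mod 155925 ∷ 38072 mod 156065 ∷ []) ∷
  (70264 mod 156975 ∷ 122597 mod 157437 ∷ 42569 mod 157905 ∷ 97249 mod 158125 ∷ []) ∷
  (23813 mod 158193 ∷ 102499 mod 159375 ∷ 85063 mod 159495 ∷ 154868 mod 159885 ∷ []) ∷
  (101870 mod 160083 ∷ 107699 mod 160875 ∷ 28916 mod 161109 ∷ 142778 mod 161161 ∷ []) ∷
  (44873 mod 161595 ∷ 126419 mod 162925 ∷ 104999 mod 163125 ∷ 139974 mod 163625 ∷ []) ∷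
  (10934 mod 164025 ∷ 95353 mod 165669 ∷ 103319 mod 166725 ∷ 52324 mod 167475 ∷ []) ∷
  (152360 mod 168399 ∷ 94324 mod 168609 ∷ 34099 mod 169125 ∷ 139697 mod 169533 ∷ []) ∷
  (25819 mod 169575 ∷ 160817 mod 169785 ∷ 136079 mod 169911 ∷ 162874 mod 170625 ∷ []) ∷
  (154889 mod 170775 ∷ 146849 mod 171171 ∷ 28124 mod 171875 ∷ 31800 mod 171941 ∷ []) ∷
  (1349 mod 172125 ∷ 134297 mod 173745 ∷ 100869 mod 174097 ∷ 20624 mod 174375 ∷ []) ∷
  (47914 mod 175175 ∷ 158318 mod 175959 ∷ 165239 mod 176175 ∷ 34253 mod 176715 ∷ []) ∷
  (59048 mod 177147 ∷ 153124 mod 177625 ∷ 27499 mod 178125 ∷ 21524 mod 179025 ∷ []) ∷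
  (88934 mod 179487 ∷ 76301 mod 180063 ∷ 104614 mod 180075 ∷ 78812 mod 180873 ∷ []) ∷
  (115574 mod 181125 ∷ 90628 mod 181545 ∷ 160819 mod 182325 ∷ 60224 mod 182875 ∷ []) ∷
  (94580 mod 183141 ∷ 111914 mod 184275 ∷ 144098 mod 184437 ∷ 79232 mod 184877 ∷ []) ∷
  (119249 mod 185625 ∷ 40823 mod 185895 ∷ 123499 mod 186875 ∷ 120119 mod 187425 ∷ []) ∷
  (180224 mod 188325 ∷ 85118 mod 188955 ∷ 138851 mod 189189 ∷ 143614 mod 189255 ∷ []) ∷
  (51449 mod 189875 ∷ 39365 mod 190269 ∷ 12004 mod 190365 ∷ 163589 mod 190575 ∷ []) ∷
  (160082 mod 191835 ∷ 163349 mod 192375 ∷ 165472 mod 192423 ∷ 62180 mod 193347 ∷ []) ∷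
  (113642 mod 195615 ∷ 189374 mod 196875 ∷ 176714 mod 196911 ∷ 125439 mod 197225 ∷ []) ∷
  [])

table₂ : List (ℕ × ℕ)
table₂ = concat (
  (118898 mod 197505 ∷ 194039 mod 198891 ∷ 64880 mod 199017 ∷ 161874 mod 199375 ∷ []) ∷
  (15794 mod 200475 ∷ 21902 mod 200655 ∷ 191974 mod 200725 ∷ 169064 mod 201825 ∷ []) ∷
  (26124 mod 201875 ∷ 52324 mod 202125 ∷ 201851 mod 202419 ∷ 165624 mod 203125 ∷ []) ∷
  (85744 mod 203775 ∷ 85063 mod 204085 ∷ 160082 mod 205065 ∷ 193969 mod 205751 ∷ []) ∷
  (56132 mod 205821 ∷ 150071 mod 207207 ∷ 101527 mod 207515 ∷ 18962 mod 207669 ∷ []) ∷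
  (139238 mod 207765 ∷ 91237 mod 208887 ∷ 154769 mod 209475 ∷ 97349 mod 210375 ∷ []) ∷
  (186934 mod 210945 ∷ 46574 mod 212625 ∷ 212561 mod 213003 ∷ 204124 mod 213125 ∷ []) ∷
  (127819 mod 213675 ∷ 204280 mod 215061 ∷ 176174 mod 215325 ∷ 126874 mod 215625 ∷ []) ∷
  (130224 mod 216125 ∷ 111536 mod 216513 ∷ 52667 mod 216783 ∷ 176903 mod 217971 ∷ []) ∷
  (118844 mod 218025 ∷ 37232 mod 218295 ∷ 114938 mod 218457 ∷ 96039 mod 218491 ∷ []) ∷
  (176624 mod 219375 ∷ 96277 mod 219765 ∷ 141965 mod 220077 ∷ 168167 mod 220255 ∷ []) ∷
  (109724 mod 221067 ∷ 175074 mod 221375 ∷ 105499 mod 223125 ∷ 33613 mod 223293 ∷ []) ∷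
  (107348 mod 223839 ∷ 116114 mod 225225 ∷ 123605 mod 226233 ∷ 213749 mod 226875 ∷ []) ∷
  (217403 mod 227205 ∷ 140776 mod 227409 ∷ 102213 mod 228095 ∷ 41999 mod 228375 ∷ []) ∷
  (160544 mod 229075 ∷ 227447 mod 229635 ∷ 104399 mod 230175 ∷ 203488 mod 230945 ∷ []) ∷
  (61235 mod 232551 ∷ 29699 mod 232875 ∷ 219068 mod 233415 ∷ 31249 mod 234375 ∷ []) ∷
  (20579 mod 234465 ∷ 47849 mod 235125 ∷ 216998 mod 235467 ∷ 128974 mod 236775 ∷ []) ∷
  (219914 mod 236925 ∷ 230278 mod 237405 ∷ 45275 mod 237699 ∷ 125824 mod 238875 ∷ []) ∷
  (117499 mod 240625 ∷ 195344 mod 240975 ∷ 222506 mod 243243 ∷ 103949 mod 244125 ∷ []) ∷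
  (168902 mod 244755 ∷ 107324 mod 245025 ∷ 45912 mod 245245 ∷ 30617 mod 246645 ∷ []) ∷
  (171664 mod 246675 ∷ 21482 mod 247401 ∷ 170585 mod 248589 ∷ 177224 mod 248625 ∷ []) ∷
  (44589 mod 248675 ∷ 51124 mod 249375 ∷ 226918 mod 250635 ∷ 203349 mod 251125 ∷ []) ∷
  (99872 mod 251505 ∷ 127252 mod 252105 ∷ 99014 mod 253575 ∷ 30293 mod 253935 ∷ []) ∷
  (251614 mod 254163 ∷ 229634 mod 255879 ∷ 87394 mod 256025 ∷ 176147 mod 257985 ∷ []) ∷
  (132074 mod 259875 ∷ 88937 mod 260253 ∷ 3331 mod 260337 ∷ 62074 mod 261625 ∷ []) ∷
  (183308 mod 262395 ∷ 233144 mod 263175 ∷ 115667 mod 263655 ∷ 143258 mod 264537 ∷ []) ∷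
  (168398 mod 264627 ∷ 140545 mod 264957 ∷ 12499 mod 265625 ∷ 77174 mod 265825 ∷ []) ∷
  (170234 mod 266409 ∷ 215269 mod 266475 ∷ 136856 mod 266511 ∷ 194774 mod 266805 ∷ []) ∷
  (239435 mod 267003 ∷ 14749 mod 268125 ∷ 112913 mod 268515 ∷ 52478 mod 268569 ∷ []) ∷
  (245969 mod 269325 ∷ 105398 mod 271215 ∷ 143749 mod 271875 ∷ 145799 mod 273375 ∷ []) ∷
  (176336 mod 273861 ∷ 237012 mod 276115 ∷ 75536 mod 276507 ∷ 162599 mod 277875 ∷ []) ∷
  (277374 mod 279125 ∷ 181277 mod 280665 ∷ 119363 mod 280917 ∷ 185464 mod 281015 ∷ []) ∷
  (156077 mod 282555 ∷ 13849 mod 282625 ∷ 119314 mod 282975 ∷ 155987 mod 283185 ∷ []) ∷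
  (180872 mod 284229 ∷ 111249 mod 284375 ∷ 33449 mod 284625 ∷ 275593 mod 285285 ∷ []) ∷
  (158465 mod 285719 ∷ 85499 mod 286875 ∷ 33956 mod 287091 ∷ 124145 mod 287793 ∷ []) ∷
  (219239 mod 289575 ∷ 184876 mod 290521 ∷ 168749 mod 290625 ∷ 268271 mod 290871 ∷ []) ∷
  (139229 mod 292383 ∷ 55418 mod 293265 ∷ 188324 mod 293625 ∷ 65669 mod 294525 ∷ []) ∷
  (275561 mod 295245 ∷ 292921 mod 295323 ∷ 28124 mod 296875 ∷ 61949 mod 298375 ∷ []) ∷
  (38807 mod 299145 ∷ 65528 mod 300105 ∷ 265922 mod 301455 ∷ 204124 mod 301875 ∷ []) ∷
  (287069 mod 302575 ∷ 126224 mod 303875 ∷ 57473 mod 305235 ∷ 226574 mod 307125 ∷ []) ∷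
  (27377 mod 307395 ∷ 98734 mod 307671 ∷ 26067 mod 308357 ∷ 127499 mod 309375 ∷ []) ∷
  (106919 mod 309825 ∷ 94114 mod 309925 ∷ 65974 mod 312375 ∷ 69254 mod 312741 ∷ []) ∷
  (290869 mod 314925 ∷ 24737 mod 315315 ∷ 61774 mod 315425 ∷ 118097 mod 317115 ∷ []) ∷
  (253819 mod 317275 ∷ 250249 mod 317625 ∷ 129194 mod 318087 ∷ 9603 mod 319333 ∷ []) ∷
  (223439 mod 319725 ∷ 17999 mod 320625 ∷ 286208 mod 320705 ∷ 161972 mod 322245 ∷ []) ∷
  (116126 mod 323323 ∷ 117989 mod 326025 ∷ 279278 mod 326781 ∷ 40624 mod 328125 ∷ []) ∷
  (316403 mod 328185 ∷ 20579 mod 328251 ∷ 70619 mod 329175 ∷ 142834 mod 331485 ∷ []) ∷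
  (232307 mod 331695 ∷ 206338 mod 332367 ∷ 332099 mod 334125 ∷ 325114 mod 334425 ∷ []) ∷
  (91853 mod 334611 ∷ 36980 mod 334719 ∷ 16574 mod 336375 ∷ 314124 mod 336875 ∷ []) ∷
  (260063 mod 337365 ∷ 174959 mod 338985 ∷ 1099 mod 339625 ∷ 243863 mod 340119 ∷ []) ∷
  (23372 mod 340659 ∷ 172724 mod 341775 ∷ 61739 mod 342657 ∷ 80947 mod 343343 ∷ []) ∷
  (138914 mod 345303 ∷ 242262 mod 346115 ∷ 106919 mod 346275 ∷ 55222 mod 348145 ∷ []) ∷
  (89599 mod 349125 ∷ 204874 mod 350625 ∷ 150919 mod 350889 ∷ 222949 mod 351575 ∷ []) ∷
  (263897 mod 352107 ∷ 33613 mod 352947 ∷ 13499 mod 354375 ∷ 196097 mod 355005 ∷ []) ∷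
  (163943 mod 355509 ∷ 113728 mod 358435 ∷ 132074 mod 358875 ∷ 306249 mod 359375 ∷ []) ∷
  (37178 mod 360855 ∷ 140552 mod 361305 ∷ 311687 mod 363285 ∷ 259349 mod 363375 ∷ []) ∷
  (71189 mod 363825 ∷ 363932 mod 364095 ∷ 20624 mod 365625 ∷ 65064 mod 366275 ∷ []) ∷
  (335708 mod 366795 ∷ 267539 mod 367353 ∷ 236774 mod 368445 ∷ 361874 mod 371875 ∷ []) ∷
  (259307 mod 372155 ∷ 187813 mod 373065 ∷ 199625 mod 373527 ∷ 190268 mod 373977 ∷ []) ∷
  (201199 mod 375375 ∷ 340118 mod 375921 ∷ 316763 mod 377055 ∷ 165624 mod 378125 ∷ []) ∷
  (136619 mod 378675 ∷ 71000 mod 379701 ∷ 153124 mod 380625 ∷ 298889 mod 382725 ∷ []) ∷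
  (210824 mod 383625 ∷ 293642 mod 384615 ∷ 348144 mod 386561 ∷ 154547 mod 387585 ∷ []) ∷
  (345374 mod 388125 ∷ 338369 mod 389025 ∷ 78124 mod 390625 ∷ 271214 mod 390775 ∷ []) ∷
  (225499 mod 391875 ∷ 386288 mod 392445 ∷ 4801 mod 393421 ∷ 282974 mod 394625 ∷ []) ∷
  (319949 mod 394875 ∷ 77804 mod 395577 ∷ 333619 mod 395675 ∷ 158122 mod 396165 ∷ []) ∷
  (351476 mod 396459 ∷ 55999 mod 398125 ∷ 59905 mod 399399 ∷ 93599 mod 401625 ∷ []) ∷
  (284282 mod 405405 ∷ 174124 mod 406875 ∷ 263249 mod 408375 ∷ 320759 mod 408969 ∷ []) ∷
  (323105 mod 410571 ∷ 238139 mod 411075 ∷ 170949 mod 411125 ∷ 382073 mod 412335 ∷ []) ∷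
  (98414 mod 413343 ∷ 205334 mod 414315 ∷ 99874 mod 414375 ∷ 49374 mod 415625 ∷ []) ∷
  (270995 mod 415701 ∷ 140874 mod 417725 ∷ 215060 mod 418803 ∷ 256364 mod 419175 ∷ []) ∷
  (374867 mod 420147 ∷ 365624 mod 421875 ∷ 125684 mod 422037 ∷ 414574 mod 422625 ∷ []) ∷
  (69794 mod 423225 ∷ 271508 mod 423605 ∷ 300068 mod 426195 ∷ 194642 mod 426465 ∷ []) ∷
  (88766 mod 427329 ∷ 170414 mod 429975 ∷ 419824 mod 430125 ∷ 353483 mod 430353 ∷ []) ∷
  (259124 mod 433125 ∷ 413828 mod 433755 ∷ 10877 mod 433895 ∷ 364069 mod 437325 ∷ []) ∷
  (267849 mod 438625 ∷ 91664 mod 439425 ∷ 138509 mod 441045 ∷ 78791 mod 441441 ∷ []) ∷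
  (336279 mod 441595 ∷ 392930 mod 443961 ∷ 194687 mod 444015 ∷ 397099 mod 444125 ∷ []) ∷
  (333738 mod 444185 ∷ 146264 mod 444675 ∷ 306062 mod 445005 ∷ 361249 mod 446875 ∷ []) ∷
  (369494 mod 447525 ∷ 171842 mod 447615 ∷ 144224 mod 448875 ∷ 154692 mod 448987 ∷ []) ∷
  (193157 mod 451143 ∷ 229634 mod 452709 ∷ 109374 mod 453125 ∷ 278207 mod 456435 ∷ []) ∷
  (32075 mod 457083 ∷ 192499 mod 459375 ∷ 416723 mod 460845 ∷ 26749 mod 463125 ∷ []) ∷
  (286747 mod 464079 ∷ 187514 mod 467775 ∷ 302182 mod 468195 ∷ 331889 mod 470925 ∷ []) ∷
  (235199 mod 471625 ∷ 368279 mod 473715 ∷ 406624 mod 474375 ∷ 22494 mod 475475 ∷ []) ∷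
  (155624 mod 478125 ∷ 104957 mod 478485 ∷ 261458 mod 479655 ∷ 451142 mod 480249 ∷ []) ∷
  (449 mod 482625 ∷ 458540 mod 483327 ∷ 423058 mod 483483 ∷ 281249 mod 484375 ∷ []) ∷
  (47529 mod 484561 ∷ 475793 mod 484785 ∷ 252104 mod 487403 ∷ 400819 mod 488775 ∷ []) ∷
  (348749 mod 489375 ∷ 91849 mod 490875 ∷ 229634 mod 492075 ∷ 156064 mod 492205 ∷ []) ∷
  (205799 mod 497007 ∷ 272194 mod 498575 ∷ 158894 mod 500175 ∷ 479170 mod 501809 ∷ []) ∷
  (288539 mod 502425 ∷ 423749 mod 503125 ∷ 96227 mod 505197 ∷ 474515 mod 505827 ∷ []) ∷
  (422252 mod 508599 ∷ 308444 mod 508725 ∷ 387197 mod 509355 ∷ 103193 mod 509733 ∷ []) ∷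
  (219749 mod 511875 ∷ 41039 mod 512325 ∷ 129947 mod 512785 ∷ 89792 mod 513513 ∷ []) ∷
  (340624 mod 515625 ∷ 363824 mod 515823 ∷ 58724 mod 516375 ∷ 334249 mod 520625 ∷ []) ∷
  (50420 mod 521017 ∷ 192212 mod 521235 ∷ 29182 mod 522291 ∷ 310724 mod 524875 ∷ []) ∷
  (452164 mod 525525 ∷ 317114 mod 528525 ∷ 131249 mod 529375 ∷ 505493 mod 530145 ∷ []) ∷
  (128281 mod 530621 ∷ 177146 mod 531441 ∷ 61249 mod 532875 ∷ 324374 mod 534375 ∷ []) ∷
  (402674 mod 537075 ∷ 96137 mod 538461 ∷ 316385 mod 540189 ∷ 47627 mod 542619 ∷ []) ∷
  (175949 mod 543375 ∷ 211658 mod 544635 ∷ 46874 mod 546875 ∷ 221594 mod 546975 ∷ []) ∷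
  (307327 mod 547085 ∷ 194974 mod 548625 ∷ 216674 mod 549423 ∷ 202124 mod 552475 ∷ []) ∷
  (357614 mod 552825 ∷ 21140 mod 553311 ∷ 467018 mod 553945 ∷ 501808 mod 554631 ∷ []) ∷
  (428624 mod 556875 ∷ 529199 mod 557375 ∷ 102788 mod 557685 ∷ 1624 mod 560625 ∷ []) ∷
  (245069 mod 562275 ∷ 337058 mod 566865 ∷ 75788 mod 567567 ∷ 529757 mod 567765 ∷ []) ∷
  (369949 mod 569625 ∷ 19682 mod 570807 ∷ 489803 mod 571095 ∷ 166319 mod 571725 ∷ []) ∷
  (570212 mod 575505 ∷ 568489 mod 575575 ∷ 483974 mod 577125 ∷ 229613 mod 577269 ∷ []) ∷
  (154790 mod 580041 ∷ 443624 mod 581875 ∷ 439999 mod 584375 ∷ 154692 mod 584815 ∷ []) ∷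
  (374462 mod 586845 ∷ 403367 mod 588245 ∷ 517499 mod 590625 ∷ 439262 mod 590733 ∷ []) ∷
  (416989 mod 591675 ∷ 184733 mod 592515 ∷ 435952 mod 593047 ∷ 164933 mod 596673 ∷ []) ∷
  (529253 mod 597051 ∷ 402499 mod 598125 ∷ 550394 mod 601425 ∷ 155672 mod 601965 ∷ []) ∷
  (533749 mod 602175 ∷ 101789 mod 605475 ∷ 73624 mod 605625 ∷ 523949 mod 606375 ∷ []) ∷
  (107358 mod 607453 ∷ 134374 mod 609375 ∷ 221594 mod 611325 ∷ 229123 mod 612255 ∷ []) ∷
  (245244 mod 614075 ∷ 153467 mod 615195 ∷ 336412 mod 617253 ∷ 610784 mod 618233 ∷ []) ∷
  (426347 mod 621621 ∷ 607694 mod 621775 ∷ 459962 mod 622545 ∷ 246266 mod 623007 ∷ []) ∷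
  (69983 mod 623295 ∷ 97249 mod 625625 ∷ 576239 mod 626661 ∷ 434069 mod 628425 ∷ []) ∷
  (447974 mod 631125 ∷ 546398 mod 632835 ∷ 590624 mod 634375 ∷ 584999 mod 639375 ∷ []) ∷
  (132593 mod 645183 ∷ 343439 mod 645975 ∷ 414374 mod 646875 ∷ 113599 mod 648375 ∷ []) ∷
  (39365 mod 649539 ∷ 508749 mod 653125 ∷ 104246 mod 653913 ∷ 264194 mod 654075 ∷ []) ∷
  (109997 mod 654885 ∷ 9233 mod 655371 ∷ 516214 mod 655473 ∷ 469124 mod 658125 ∷ []) ∷
  (609062 mod 659295 ∷ 508760 mod 660231 ∷ 361864 mod 660275 ∷ 364412 mod 660765 ∷ []) ∷
  (449063 mod 665665 ∷ 477374 mod 669375 ∷ 405800 mod 671517 ∷ 266264 mod 675675 ∷ []) ∷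
  (148749 mod 678125 ∷ 584999 mod 680625 ∷ 596078 mod 681615 ∷ 519791 mod 682227 ∷ []) ∷
  (18178 mod 684285 ∷ 574874 mod 685125 ∷ 537844 mod 687225 ∷ 150902 mod 688905 ∷ []) ∷
  (419174 mod 690525 ∷ 605624 mod 690625 ∷ 645523 mod 692835 ∷ 638603 mod 697653 ∷ []) ∷
  (154692 mod 698005 ∷ 107324 mod 698625 ∷ 374678 mod 700245 ∷ 656249 mod 703125 ∷ []) ∷
  (457169 mod 703395 ∷ 38499 mod 704375 ∷ 596474 mod 705375 ∷ 609443 mod 706401 ∷ []) ∷
  (298889 mod 710775 ∷ 546818 mod 712215 ∷ 523949 mod 716625 ∷ 316588 mod 717899 ∷ []) ∷
  (220624 mod 721875 ∷ 596969 mod 722925 ∷ 307474 mod 728875 ∷ 384668 mod 729729 ∷ []) ∷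
  (607949 mod 732375 ∷ 64777 mod 735735 ∷ 294272 mod 739935 ∷ 7214 mod 740025 ∷ []) ∷
  (269499 mod 741125 ∷ 351350 mod 742203 ∷ 266813 mod 745767 ∷ 508724 mod 745875 ∷ []) ∷
  (567664 mod 746025 ∷ 134249 mod 748125 ∷ 96137 mod 751905 ∷ 362599 mod 753375 ∷ []) ∷
  (686717 mod 754515 ∷ 14489 mod 760725 ∷ 114938 mod 761805 ∷ 336335 mod 762489 ∷ []) ∷
  [])

table₃ : List (ℕ × ℕ)
table₃ = concat (
  (412971 mod 765919 ∷ 570806 mod 767637 ∷ 734194 mod 768075 ∷ 321249 mod 771875 ∷ []) ∷
  (452759 mod 773465 ∷ 348137 mod 773955 ∷ 443155 mod 775523 ∷ 738449 mod 779625 ∷ []) ∷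
  (318989 mod 780325 ∷ 522692 mod 780759 ∷ 350447 mod 781011 ∷ 164449 mod 784875 ∷ []) ∷
  (270773 mod 787185 ∷ 74249 mod 789525 ∷ 223749 mod 790625 ∷ 141182 mod 790965 ∷ []) ∷
  (319616 mod 793611 ∷ 288683 mod 793881 ∷ 130787 mod 794871 ∷ 293749 mod 796875 ∷ []) ∷
  (274399 mod 797475 ∷ 791855 mod 799227 ∷ 570569 mod 799425 ∷ 144059 mod 799533 ∷ []) ∷
  (160082 mod 800415 ∷ 497825 mod 801009 ∷ 461624 mod 804375 ∷ 202418 mod 805545 ∷ []) ∷
  (542177 mod 805805 ∷ 335744 mod 807975 ∷ 387099 mod 814625 ∷ 262499 mod 815625 ∷ []) ∷
  (761749 mod 818125 ∷ 581041 mod 818741 ∷ 765232 mod 828345 ∷ 812888 mod 829521 ∷ []) ∷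
  (69974 mod 833625 ∷ 659735 mod 833833 ∷ 352624 mod 837375 ∷ 274832 mod 841995 ∷ []) ∷
  (527239 mod 843045 ∷ 250262 mod 847665 ∷ 263224 mod 847875 ∷ 15497 mod 849555 ∷ []) ∷
  (812591 mod 852687 ∷ 811249 mod 853125 ∷ 223199 mod 853875 ∷ 370688 mod 855855 ∷ []) ∷
  (343342 mod 857157 ∷ 62499 mod 859375 ∷ 126664 mod 859705 ∷ 276749 mod 860625 ∷ []) ∷
  (220076 mod 863379 ∷ 412289 mod 868725 ∷ 653883 mod 870485 ∷ 244901 mod 871563 ∷ []) ∷
  (262499 mod 871875 ∷ 365228 mod 872613 ∷ 82949 mod 875875 ∷ 41768 mod 877149 ∷ []) ∷
  (250928 mod 879795 ∷ 735074 mod 880875 ∷ 458369 mod 883575 ∷ 472391 mod 885735 ∷ []) ∷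
  (471624 mod 888125 ∷ 668749 mod 890625 ∷ 188824 mod 895125 ∷ 418802 mod 897435 ∷ []) ∷
  (865808 mod 900315 ∷ 827252 mod 904365 ∷ 405374 mod 905625 ∷ 54319 mod 907725 ∷ []) ∷
  (780724 mod 911625 ∷ 864874 mod 914375 ∷ 159218 mod 915705 ∷ 738449 mod 921375 ∷ []) ∷
  (232307 mod 922185 ∷ 611519 mod 923013 ∷ 667477 mod 924385 ∷ 777923 mod 925071 ∷ []) ∷
  (230624 mod 928125 ∷ 3644 mod 929475 ∷ 694770 mod 931931 ∷ 48749 mod 934375 ∷ []) ∷
  (903230 mod 938223 ∷ 500819 mod 944775 ∷ 760472 mod 945945 ∷ 317524 mod 946275 ∷ []) ∷
  (12249 mod 949375 ∷ 282122 mod 951345 ∷ 763174 mod 951825 ∷ 419999 mod 952875 ∷ []) ∷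
  (235223 mod 954261 ∷ 883567 mod 957999 ∷ 124874 mod 961875 ∷ 663508 mod 962115 ∷ []) ∷
  (386504 mod 966735 ∷ 464320 mod 969969 ∷ 211287 mod 977207 ∷ 661364 mod 978075 ∷ []) ∷
  (388205 mod 980343 ∷ 149999 mod 984375 ∷ 207008 mod 984555 ∷ 394106 mod 984753 ∷ []) ∷
  (835449 mod 986125 ∷ 948419 mod 987525 ∷ 747053 mod 994455 ∷ 121742 mod 995085 ∷ []) ∷
  (134374 mod 996875 ∷ 95549 mod 997101 ∷ 777599 mod 1002375 ∷ 962324 mod 1003625 ∷ []) ∷
  (984149 mod 1003833 ∷ 817991 mod 1004157 ∷ 128699 mod 1009125 ∷ 308749 mod 1009375 ∷ []) ∷
  (699124 mod 1010625 ∷ 35153 mod 1012095 ∷ 124999 mod 1015625 ∷ 941599 mod 1018875 ∷ []) ∷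
  (470609 mod 1020357 ∷ 819769 mod 1020425 ∷ 425564 mod 1025325 ∷ 1714 mod 1030029 ∷ []) ∷
  (490489 mod 1037575 ∷ 1009952 mod 1038345 ∷ 222344 mod 1038825 ∷ 1022999 mod 1051875 ∷ []) ∷
  (583099 mod 1054725 ∷ 850742 mod 1056321 ∷ 314432 mod 1065015 ∷ 274999 mod 1065625 ∷ []) ∷
  (756458 mod 1066527 ∷ 453298 mod 1075305 ∷ 1072574 mod 1076625 ∷ 40624 mod 1078125 ∷ []) ∷
  (519249 mod 1080625 ∷ 879173 mod 1082565 ∷ 905176 mod 1082851 ∷ 726452 mod 1083915 ∷ []) ∷
  (432782 mod 1089855 ∷ 380474 mod 1090125 ∷ 164267 mod 1092285 ∷ 283317 mod 1092455 ∷ []) ∷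
  (264374 mod 1096875 ∷ 272089 mod 1098825 ∷ 91178 mod 1100385 ∷ 376529 mod 1105335 ∷ []) ∷
  (42249 mod 1106875 ∷ 908749 mod 1115625 ∷ 573838 mod 1116465 ∷ 436523 mod 1119195 ∷ []) ∷
  (688904 mod 1121931 ∷ 701699 mod 1126125 ∷ 214811 mod 1127763 ∷ 442077 mod 1128127 ∷ []) ∷
  (945188 mod 1131165 ∷ 234374 mod 1134375 ∷ 262844 mod 1136025 ∷ 56594 mod 1140475 ∷ []) ∷
  (388499 mod 1141875 ∷ 23099 mod 1145375 ∷ 631574 mod 1150875 ∷ 388244 mod 1154725 ∷ []) ∷
  (213688 mod 1159683 ∷ 1116827 mod 1162755 ∷ 215999 mod 1164375 ∷ 79019 mod 1167075 ∷ []) ∷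
  (546874 mod 1171875 ∷ 28664 mod 1172325 ∷ 94874 mod 1175625 ∷ 909548 mod 1177335 ∷ []) ∷
  (445213 mod 1180263 ∷ 908599 mod 1183875 ∷ 1132676 mod 1186731 ∷ 752569 mod 1187025 ∷ []) ∷
  (1082507 mod 1188495 ∷ 829079 mod 1189377 ∷ 699124 mod 1194375 ∷ 1124969 mod 1198197 ∷ []) ∷
  (165624 mod 1203125 ∷ 629099 mod 1204875 ∷ 14012 mod 1216215 ∷ 75998 mod 1218679 ∷ []) ∷
  (734999 mod 1220625 ∷ 3374 mod 1225125 ∷ 1174039 mod 1226225 ∷ 457082 mod 1226907 ∷ []) ∷
  (606689 mod 1233225 ∷ 1207699 mod 1233375 ∷ 1069298 mod 1237005 ∷ 649538 mod 1240029 ∷ []) ∷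
  (940409 mod 1242945 ∷ 376124 mod 1243125 ∷ 749374 mod 1246875 ∷ 1240964 mod 1247103 ∷ []) ∷
  (6124 mod 1253175 ∷ 45275 mod 1256409 ∷ 954989 mod 1257525 ∷ 935063 mod 1260441 ∷ []) ∷
  (911546 mod 1266111 ∷ 555449 mod 1267875 ∷ 1198394 mod 1269675 ∷ 401848 mod 1270815 ∷ []) ∷
  (52487 mod 1279395 ∷ 138599 mod 1280125 ∷ 800981 mod 1281987 ∷ 496934 mod 1291059 ∷ []) ∷
  (554630 mod 1294139 ∷ 547874 mod 1299375 ∷ 992168 mod 1301265 ∷ 9749 mod 1308125 ∷ []) ∷
  (56099 mod 1315875 ∷ 1301264 mod 1323135 ∷ 814526 mod 1324323 ∷ 634654 mod 1324785 ∷ []) ∷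
  (1234374 mod 1328125 ∷ 222949 mod 1329125 ∷ 934712 mod 1332045 ∷ 161974 mod 1332375 ∷ []) ∷
  (1066043 mod 1332555 ∷ 631364 mod 1334025 ∷ 919862 mod 1335015 ∷ 979999 mod 1340625 ∷ []) ∷
  (220319 mod 1342575 ∷ 969317 mod 1342845 ∷ 892349 mod 1346625 ∷ 1237543 mod 1346961 ∷ []) ∷
  (542429 mod 1353429 ∷ 984149 mod 1358127 ∷ 1203124 mod 1359375 ∷ 1343222 mod 1369305 ∷ []) ∷
  (1250963 mod 1371249 ∷ 181789 mod 1380575 ∷ 570338 mod 1382535 ∷ 1107374 mod 1389375 ∷ []) ∷
  (441440 mod 1392237 ∷ 179374 mod 1395625 ∷ 967139 mod 1403325 ∷ 1082507 mod 1404585 ∷ []) ∷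
  (1233574 mod 1405075 ∷ 1116764 mod 1412775 ∷ 352999 mod 1413125 ∷ 572074 mod 1414875 ∷ []) ∷
  (498959 mod 1421145 ∷ 509374 mod 1421875 ∷ 90374 mod 1423125 ∷ 1302619 mod 1426425 ∷ []) ∷
  (813938 mod 1428595 ∷ 314999 mod 1434375 ∷ 1247147 mod 1435455 ∷ 581228 mod 1438965 ∷ []) ∷
  (1340296 mod 1440257 ∷ 161324 mod 1447875 ∷ 1264085 mod 1449981 ∷ 1067702 mod 1450449 ∷ []) ∷
  (271312 mod 1452605 ∷ 1265624 mod 1453125 ∷ 314198 mod 1454355 ∷ 1093499 mod 1468125 ∷ []) ∷
  (419099 mod 1472625 ∷ 393659 mod 1476225 ∷ 768319 mod 1476615 ∷ 1156249 mod 1484375 ∷ []) ∷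
  (121624 mod 1491875 ∷ 1484944 mod 1495725 ∷ 1325969 mod 1500525 ∷ 1033801 mod 1505427 ∷ []) ∷
  (1466639 mod 1507275 ∷ 445624 mod 1509375 ∷ 408099 mod 1512875 ∷ 938222 mod 1515591 ∷ []) ∷
  (843632 mod 1517481 ∷ 1098624 mod 1519375 ∷ 252719 mod 1525797 ∷ 1156319 mod 1526175 ∷ []) ∷
  (907577 mod 1529437 ∷ 902249 mod 1535625 ∷ 211814 mod 1536975 ∷ 1289287 mod 1538355 ∷ []) ∷
  (945647 mod 1540539 ∷ 684374 mod 1546875 ∷ 1093091 mod 1547469 ∷ 775949 mod 1549625 ∷ []) ∷
  (1252999 mod 1561875 ∷ 991612 mod 1563051 ∷ 887192 mod 1563705 ∷ 203279 mod 1566873 ∷ []) ∷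
  (1424599 mod 1574625 ∷ 276989 mod 1576575 ∷ 846074 mod 1577125 ∷ 590489 mod 1585575 ∷ []) ∷
  (192499 mod 1588125 ∷ 858923 mod 1590435 ∷ 985438 mod 1591863 ∷ 531440 mod 1594323 ∷ []) ∷
  (1438198 mod 1596665 ∷ 146249 mod 1603125 ∷ 29644 mod 1603525 ∷ 1099349 mod 1611225 ∷ []) ∷
  (496448 mod 1620567 ∷ 1039310 mod 1627857 ∷ 900449 mod 1630125 ∷ 1119383 mod 1633905 ∷ []) ∷
  (828124 mod 1640625 ∷ 1497869 mod 1640925 ∷ 250732 mod 1641255 ∷ 926474 mod 1645875 ∷ []) ∷
  (582956 mod 1648269 ∷ 1104949 mod 1657425 ∷ 1094714 mod 1658475 ∷ 758888 mod 1659933 ∷ []) ∷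
  (1281643 mod 1661835 ∷ 799874 mod 1670625 ∷ 57574 mod 1672125 ∷ 288683 mod 1673055 ∷ []) ∷
  (1496624 mod 1681875 ∷ 1526874 mod 1684375 ∷ 426464 mod 1694925 ∷ 204874 mod 1698125 ∷ []) ∷
  (1659743 mod 1700595 ∷ 1021733 mod 1702701 ∷ 805967 mod 1703295 ∷ 1003832 mod 1712421 ∷ []) ∷
  (321047 mod 1713285 ∷ 1424114 mod 1715175 ∷ 326192 mod 1716715 ∷ 365147 mod 1726515 ∷ []) ∷
  (1576574 mod 1731807 ∷ 865808 mod 1740123 ∷ 876364 mod 1740725 ∷ 229249 mod 1745625 ∷ []) ∷
  (1677499 mod 1753125 ∷ 897973 mod 1754445 ∷ 570077 mod 1760535 ∷ 1243717 mod 1764735 ∷ []) ∷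
  (636173 mod 1772199 ∷ 1567268 mod 1777545 ∷ 1667665 mod 1779141 ∷ 131219 mod 1791153 ∷ []) ∷
  (1404094 mod 1792175 ∷ 593749 mod 1796875 ∷ 1552769 mod 1804275 ∷ 1110914 mod 1816425 ∷ []) ∷
  (477374 mod 1816875 ∷ 635578 mod 1822359 ∷ 1556249 mod 1828125 ∷ 211574 mod 1831375 ∷ []) ∷
  (629144 mod 1833975 ∷ 1045463 mod 1836765 ∷ 1494569 mod 1842225 ∷ 747914 mod 1851759 ∷ []) ∷
  (1178890 mod 1854699 ∷ 1403124 mod 1859375 ∷ 633554 mod 1864863 ∷ 1083169 mod 1865325 ∷ []) ∷
  (403367 mod 1867635 ∷ 485513 mod 1869885 ∷ 1252249 mod 1876875 ∷ 1609374 mod 1890625 ∷ []) ∷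
  (1499849 mod 1893375 ∷ 515528 mod 1898505 ∷ 1399999 mod 1903125 ∷ 1072499 mod 1918125 ∷ []) ∷
  (79232 mod 1932805 ∷ 1853081 mod 1935549 ∷ 31589 mod 1937925 ∷ 1276874 mod 1940625 ∷ []) ∷
  (1194224 mod 1945125 ∷ 472391 mod 1948617 ∷ 390624 mod 1953125 ∷ 1316874 mod 1953875 ∷ []) ∷
  (852499 mod 1959375 ∷ 1848014 mod 1961739 ∷ 700244 mod 1962225 ∷ 1263954 mod 1967105 ∷ []) ∷
  (1488122 mod 1977885 ∷ 175349 mod 1978375 ∷ 948914 mod 1980693 ∷ 78889 mod 1980825 ∷ []) ∷
  (1329999 mod 1990625 ∷ 397858 mod 1996995 ∷ 403367 mod 2000033 ∷ 254249 mod 2008125 ∷ []) ∷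
  (1301156 mod 2014551 ∷ 41039 mod 2027025 ∷ 218490 mod 2033647 ∷ 1451249 mod 2041875 ∷ []) ∷
  (368873 mod 2044845 ∷ 974609 mod 2046681 ∷ 474368 mod 2052855 ∷ 930824 mod 2055375 ∷ []) ∷
  (1650999 mod 2055625 ∷ 1454144 mod 2061675 ∷ 1987982 mod 2066715 ∷ 1508749 mod 2071875 ∷ []) ∷
  (215624 mod 2078125 ∷ 1800248 mod 2078505 ∷ 131074 mod 2088625 ∷ 157463 mod 2092959 ∷ []) ∷
  (1267727 mod 2094015 ∷ 1541753 mod 2100735 ∷ 722357 mod 2110185 ∷ 160999 mod 2113125 ∷ []) ∷
  (831599 mod 2116125 ∷ 1627044 mod 2118025 ∷ 1080377 mod 2119203 ∷ 1496438 mod 2136645 ∷ []) ∷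
  (1065700 mod 2153697 ∷ 1904999 mod 2165625 ∷ 1801844 mod 2168775 ∷ 271214 mod 2169475 ∷ []) ∷
  (1850974 mod 2186625 ∷ 141425 mod 2189187 ∷ 1781492 mod 2207205 ∷ 658524 mod 2207975 ∷ []) ∷
  (745037 mod 2219805 ∷ 993914 mod 2220075 ∷ 1462999 mod 2220625 ∷ 1428594 mod 2220925 ∷ []) ∷
  (943249 mod 2223375 ∷ 2083157 mod 2226609 ∷ 1165624 mod 2234375 ∷ 420174 mod 2235331 ∷ []) ∷
  (11474 mod 2237625 ∷ 1131749 mod 2244375 ∷ 973433 mod 2244935 ∷ 1575692 mod 2255715 ∷ []) ∷
  (162315 mod 2263261 ∷ 938222 mod 2263545 ∷ 1953124 mod 2265625 ∷ 368873 mod 2285415 ∷ []) ∷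
  (1352987 mod 2287467 ∷ 386560 mod 2297757 ∷ 826685 mod 2302911 ∷ 1246244 mod 2304225 ∷ []) ∷
  (1508749 mod 2315625 ∷ 918553 mod 2326569 ∷ 1777949 mod 2338875 ∷ 1519489 mod 2340975 ∷ []) ∷
  (1823957 mod 2342277 ∷ 610784 mod 2343033 ∷ 426074 mod 2354625 ∷ 2279474 mod 2368575 ∷ []) ∷
  (2114374 mod 2371875 ∷ 878349 mod 2377375 ∷ 848690 mod 2380833 ∷ 1732103 mod 2381643 ∷ []) ∷
  (1312352 mod 2384613 ∷ 824999 mod 2390625 ∷ 1058264 mod 2397681 ∷ 837044 mod 2398275 ∷ []) ∷
  (1280663 mod 2401245 ∷ 1944809 mod 2403401 ∷ 193499 mod 2413125 ∷ 1276478 mod 2416635 ∷ []) ∷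
  (2109374 mod 2421875 ∷ 2221019 mod 2423925 ∷ 319332 mod 2437015 ∷ 987349 mod 2443875 ∷ []) ∷
  (1631249 mod 2446875 ∷ 2349874 mod 2454375 ∷ 1294138 mod 2456223 ∷ 336139 mod 2461025 ∷ []) ∷
  (1869692 mod 2485035 ∷ 2195423 mod 2488563 ∷ 1459349 mod 2500875 ∷ 1086623 mod 2509045 ∷ []) ∷
  (1884749 mod 2512125 ∷ 2134374 mod 2515625 ∷ 555497 mod 2525985 ∷ 532817 mod 2542995 ∷ []) ∷
  (2241599 mod 2543625 ∷ 1606472 mod 2558061 ∷ 526874 mod 2559375 ∷ 2500199 mod 2561625 ∷ []) ∷
  (745289 mod 2563925 ∷ 1511828 mod 2567565 ∷ 2093749 mod 2578125 ∷ 507869 mod 2590137 ∷ []) ∷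
  (1583749 mod 2603125 ∷ 2588277 mod 2605085 ∷ 1860164 mod 2606175 ∷ 1626778 mod 2611455 ∷ []) ∷
  (1591862 mod 2614689 ∷ 2137499 mod 2615625 ∷ 1528712 mod 2617839 ∷ 1255499 mod 2624375 ∷ []) ∷
  (2238949 mod 2627625 ∷ 2380832 mod 2631447 ∷ 481249 mod 2646875 ∷ 2520044 mod 2650725 ∷ []) ∷
  (1948616 mod 2657205 ∷ 1696624 mod 2664375 ∷ 965624 mod 2671875 ∷ 1497824 mod 2685375 ∷ []) ∷
  (1624202 mod 2692305 ∷ 565703 mod 2700945 ∷ 789928 mod 2705927 ∷ 2292947 mod 2713095 ∷ []) ∷
  (1914749 mod 2716875 ∷ 2172344 mod 2723175 ∷ 1796874 mod 2734375 ∷ 2300099 mod 2734875 ∷ []) ∷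
  (2359839 mod 2735425 ∷ 1731124 mod 2743125 ∷ 1380158 mod 2747115 ∷ 1352699 mod 2764125 ∷ []) ∷
  (2691467 mod 2766555 ∷ 303848 mod 2769039 ∷ 1464119 mod 2769725 ∷ 1459807 mod 2773155 ∷ []) ∷
  [])

table₄ : List (ℕ × ℕ)
table₄ = concat (
  (2513356 mod 2795793 ∷ 1795624 mod 2803125 ∷ 1528712 mod 2814669 ∷ 1130669 mod 2834325 ∷ []) ∷
  (2021732 mod 2837835 ∷ 318499 mod 2848125 ∷ 1889567 mod 2854035 ∷ 2461832 mod 2862783 ∷ []) ∷
  (1028949 mod 2877875 ∷ 2267033 mod 2886345 ∷ 1221317 mod 2900205 ∷ 2305624 mod 2909375 ∷ []) ∷
  (2727581 mod 2909907 ∷ 2543749 mod 2921875 ∷ 1963674 mod 2924075 ∷ 2852387 mod 2931621 ∷ []) ∷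
  (1313414 mod 2934225 ∷ 1695329 mod 2941029 ∷ 1847933 mod 2953665 ∷ 535324 mod 2958375 ∷ []) ∷
  (1606769 mod 2962575 ∷ 1602838 mod 2965235 ∷ 1620233 mod 2983365 ∷ 785132 mod 2985255 ∷ []) ∷
  (2712499 mod 2990625 ∷ 760283 mod 2991303 ∷ 2114099 mod 3007125 ∷ 12949 mod 3010875 ∷ []) ∷
  (1152710 mod 3012471 ∷ 465074 mod 3027375 ∷ 2980624 mod 3028125 ∷ 2986157 mod 3037265 ∷ []) ∷
  (2937499 mod 3046875 ∷ 2300099 mod 3056625 ∷ 1150847 mod 3061071 ∷ 2800594 mod 3061275 ∷ []) ∷
  (1718429 mod 3090087 ∷ 1731904 mod 3091165 ∷ 1975599 mod 3108875 ∷ 2641099 mod 3112725 ∷ []) ∷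
  (1598749 mod 3128125 ∷ 2024042 mod 3133305 ∷ 1822358 mod 3142909 ∷ 321749 mod 3155625 ∷ []) ∷
  (2611277 mod 3168963 ∷ 743749 mod 3171875 ∷ 3196874 mod 3196875 ∷ 2534003 mod 3199581 ∷ []) ∷
  (811733 mod 3225915 ∷ 2668949 mod 3229875 ∷ 1837499 mod 3234375 ∷ 3096124 mod 3241875 ∷ []) ∷
  (157463 mod 3247695 ∷ 1380574 mod 3248553 ∷ 1684374 mod 3265625 ∷ 2975777 mod 3269565 ∷ []) ∷
  (1833974 mod 3270375 ∷ 703492 mod 3277365 ∷ 1004639 mod 3296475 ∷ 457973 mod 3301155 ∷ []) ∷
  (1380994 mod 3328325 ∷ 1280624 mod 3346875 ∷ 2301848 mod 3357585 ∷ 1077074 mod 3378375 ∷ []) ∷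
  (2094416 mod 3383289 ∷ 2011645 mod 3384381 ∷ 3328124 mod 3403125 ∷ 2913569 mod 3408075 ∷ []) ∷
  (1411787 mod 3411821 ∷ 1797319 mod 3421425 ∷ 2606624 mod 3425625 ∷ 1774849 mod 3436125 ∷ []) ∷
  (1434374 mod 3453125 ∷ 2446894 mod 3464175 ∷ 3212702 mod 3488265 ∷ 2414719 mod 3490025 ∷ []) ∷
  (1635119 mod 3501225 ∷ 765918 mod 3512663 ∷ 937499 mod 3515625 ∷ 1039289 mod 3516975 ∷ []) ∷
  (2292499 mod 3521875 ∷ 878624 mod 3526875 ∷ 2479328 mod 3532005 ∷ 3110561 mod 3560193 ∷ []) ∷
  (1543919 mod 3561075 ∷ 1814812 mod 3589495 ∷ 1923767 mod 3594591 ∷ 509374 mod 3609375 ∷ []) ∷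
  (1030724 mod 3614625 ∷ 2352979 mod 3647119 ∷ 1635632 mod 3648645 ∷ 1222990 mod 3656037 ∷ []) ∷
  (400949 mod 3675375 ∷ 3154864 mod 3678675 ∷ 3319865 mod 3680721 ∷ 3263324 mod 3700125 ∷ []) ∷
  (1145374 mod 3705625 ∷ 656963 mod 3711015 ∷ 2326568 mod 3714347 ∷ 1060694 mod 3728835 ∷ []) ∷
  (2447999 mod 3729375 ∷ 2827499 mod 3740625 ∷ 1656665 mod 3741309 ∷ 1580543 mod 3769227 ∷ []) ∷
  (1355210 mod 3781323 ∷ 2710826 mod 3798333 ∷ 3314519 mod 3809025 ∷ 3790688 mod 3812445 ∷ []) ∷
  (571437 mod 3829595 ∷ 3464207 mod 3838185 ∷ 273349 mod 3840375 ∷ 373652 mod 3845961 ∷ []) ∷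
  (12499 mod 3859375 ∷ 3509405 mod 3873177 ∷ 2287123 mod 3877615 ∷ 3512662 mod 3882417 ∷ []) ∷
  (114749 mod 3898125 ∷ 2727188 mod 3903795 ∷ 635374 mod 3924375 ∷ 1871099 mod 3947625 ∷ []) ∷
  (3228124 mod 3953125 ∷ 1541834 mod 3969405 ∷ 453124 mod 3984375 ∷ 2924074 mod 3987375 ∷ []) ∷
  (3154787 mod 3996135 ∷ 1050224 mod 3997125 ∷ 1894388 mod 3997665 ∷ 1431044 mod 4002075 ∷ []) ∷
  (1426874 mod 4021875 ∷ 2457944 mod 4027725 ∷ 3281914 mod 4029025 ∷ 1790099 mod 4039875 ∷ []) ∷
  (3033491 mod 4040883 ∷ 1889567 mod 4074381 ∷ 3328124 mod 4078125 ∷ 3052499 mod 4090625 ∷ []) ∷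
  (1795947 mod 4093705 ∷ 3536378 mod 4113747 ∷ 1262239 mod 4141725 ∷ 1031183 mod 4147605 ∷ []) ∷
  (3824792 mod 4151329 ∷ 1570499 mod 4168125 ∷ 3701312 mod 4176711 ∷ 901249 mod 4186875 ∷ []) ∷
  (3306014 mod 4209975 ∷ 524299 mod 4215225 ∷ 3471389 mod 4238325 ∷ 602374 mod 4239375 ∷ []) ∷
  (280916 mod 4252171 ∷ 1283039 mod 4263435 ∷ 1493749 mod 4265625 ∷ 564749 mod 4269375 ∷ []) ∷
  (2253569 mod 4279275 ∷ 141658 mod 4285785 ∷ 1093749 mod 4296875 ∷ 1540538 mod 4316895 ∷ []) ∷
  (3334498 mod 4320771 ∷ 2801280 mod 4327631 ∷ 3539699 mod 4343625 ∷ 780758 mod 4349943 ∷ []) ∷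
  (3001634 mod 4351347 ∷ 2917144 mod 4352425 ∷ 1855972 mod 4357815 ∷ 2765624 mod 4359375 ∷ []) ∷
  (1283768 mod 4363065 ∷ 3761624 mod 4379375 ∷ 4346099 mod 4417875 ∷ 3838184 mod 4428675 ∷ []) ∷
  (1439374 mod 4440625 ∷ 2093749 mod 4453125 ∷ 2142874 mod 4475625 ∷ 325619 mod 4501575 ∷ []) ∷
  (3542846 mod 4516281 ∷ 677564 mod 4521825 ∷ 948749 mod 4528125 ∷ 1688224 mod 4538625 ∷ []) ∷
  (3464207 mod 4546773 ∷ 2968624 mod 4558125 ∷ 1230624 mod 4571875 ∷ 1269917 mod 4577391 ∷ []) ∷
  (2173769 mod 4578525 ∷ 2201716 mod 4588311 ∷ 2949749 mod 4606875 ∷ 2261114 mod 4610925 ∷ []) ∷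
  (3340427 mod 4615065 ∷ 3513212 mod 4621617 ∷ 1715624 mod 4640625 ∷ 3301913 mod 4659655 ∷ []) ∷
  (2478124 mod 4671875 ∷ 1408427 mod 4691115 ∷ 3859316 mod 4700619 ∷ 3524099 mod 4723875 ∷ []) ∷
  (1328039 mod 4729725 ∷ 3563074 mod 4731375 ∷ 3542939 mod 4756725 ∷ 3451874 mod 4764375 ∷ []) ∷
  (1919213 mod 4771305 ∷ 3638543 mod 4775589 ∷ 1594322 mod 4782969 ∷ 2950828 mod 4789995 ∷ []) ∷
  (2010469 mod 4810575 ∷ 1036637 mod 4861701 ∷ 1426193 mod 4886035 ∷ 1443824 mod 4890375 ∷ []) ∷
  (574748 mod 4901715 ∷ 1921874 mod 4921875 ∷ 403919 mod 4922775 ∷ 3382322 mod 4923765 ∷ []) ∷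
  (3120974 mod 4937625 ∷ 3330071 mod 4944807 ∷ 3306014 mod 4975425 ∷ 1312199 mod 4979799 ∷ []) ∷
  (4843749 mod 4984375 ∷ 3497423 mod 4985505 ∷ 2519423 mod 5019165 ∷ 1342158 mod 5025293 ∷ []) ∷
  (935999 mod 5045625 ∷ 2731249 mod 5046875 ∷ 3933124 mod 5053125 ∷ 2968749 mod 5078125 ∷ []) ∷
  (2164249 mod 5094375 ∷ 526013 mod 5101785 ∷ 5137262 mod 5137263 ∷ 3711014 mod 5145525 ∷ []) ∷
  (590302 mod 5150145 ∷ 3395699 mod 5187875 ∷ 516214 mod 5222175 ∷ 4599374 mod 5259375 ∷ []) ∷
  (4195232 mod 5263335 ∷ 2917457 mod 5281605 ∷ 4771304 mod 5316597 ∷ 1890624 mod 5328125 ∷ []) ∷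
  (2159783 mod 5332635 ∷ 4039853 mod 5337423 ∷ 2519423 mod 5373459 ∷ 2818969 mod 5376525 ∷ []) ∷
  (1765624 mod 5390625 ∷ 1383749 mod 5403125 ∷ 4559894 mod 5412825 ∷ 456189 mod 5414255 ∷ []) ∷
  (3102091 mod 5428661 ∷ 4138289 mod 5449275 ∷ 1688624 mod 5450625 ∷ 1243031 mod 5467077 ∷ []) ∷
  (52324 mod 5494125 ∷ 1851794 mod 5501925 ∷ 2698749 mod 5534375 ∷ 3834179 mod 5555277 ∷ []) ∷
  (3809374 mod 5578125 ∷ 3120038 mod 5594589 ∷ 3570269 mod 5595975 ∷ 5471873 mod 5609655 ∷ []) ∷
  (2503499 mod 5630625 ∷ 196832 mod 5640635 ∷ 4015624 mod 5671875 ∷ 2762099 mod 5680125 ∷ []) ∷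
  (4042499 mod 5709375 ∷ 3917374 mod 5726875 ∷ 2773154 mod 5731187 ∷ 3621474 mod 5773625 ∷ []) ∷
  (4196947 mod 5798415 ∷ 4107914 mod 5813775 ∷ 545849 mod 5835375 ∷ 5067138 mod 5836831 ∷ []) ∷
  (5668703 mod 5845851 ∷ 781249 mod 5859375 ∷ 5665624 mod 5861625 ∷ 1505624 mod 5878125 ∷ []) ∷
  (1194101 mod 5885217 ∷ 3970619 mod 5886675 ∷ 1823044 mod 5901315 ∷ 4125302 mod 5933655 ∷ []) ∷
  (989974 mod 5935125 ∷ 2269376 mod 5942079 ∷ 1176874 mod 5971875 ∷ 3060518 mod 5990985 ∷ []) ∷
  (4874029 mod 6000099 ∷ 1609374 mod 6015625 ∷ 1592999 mod 6024375 ∷ 6001775 mod 6043653 ∷ []) ∷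
  (3419414 mod 6081075 ∷ 1151303 mod 6093395 ∷ 33613 mod 6100941 ∷ 5906249 mod 6125625 ∷ []) ∷
  (5588449 mod 6131125 ∷ 3776948 mod 6134535 ∷ 5726699 mod 6166125 ∷ 220999 mod 6166875 ∷ []) ∷
  (79694 mod 6185025 ∷ 5432507 mod 6200145 ∷ 127499 mod 6215625 ∷ 1746874 mod 6234375 ∷ []) ∷
  (5264423 mod 6235515 ∷ 333199 mod 6265875 ∷ 964466 mod 6278877 ∷ 1709168 mod 6282045 ∷ []) ∷
  (5042978 mod 6302205 ∷ 649592 mod 6330555 ∷ 5769224 mod 6348375 ∷ 4722619 mod 6354075 ∷ []) ∷
  (2493179 mod 6357609 ∷ 2954874 mod 6400625 ∷ 4345298 mod 6409935 ∷ 347801 mod 6461091 ∷ []) ∷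
  (5025292 mod 6470695 ∷ 2626874 mod 6496875 ∷ 5416469 mod 6506325 ∷ 162238 mod 6523517 ∷ []) ∷
  (2364374 mod 6540625 ∷ 3790070 mod 6567561 ∷ 2517227 mod 6621615 ∷ 1338049 mod 6623925 ∷ []) ∷
  (703124 mod 6640625 ∷ 1733939 mod 6660225 ∷ 6557374 mod 6661875 ∷ 228094 mod 6662775 ∷ []) ∷
  (5806249 mod 6703125 ∷ 5126134 mod 6705993 ∷ 757349 mod 6712875 ∷ 4124249 mod 6733125 ∷ []) ∷
  (5199193 mod 6734805 ∷ 1284632 mod 6767145 ∷ 5037031 mod 6789783 ∷ 1692737 mod 6790635 ∷ []) ∷
  (6406249 mod 6796875 ∷ 3416093 mod 6856245 ∷ 360149 mod 6893271 ∷ 1594322 mod 6908733 ∷ []) ∷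
  (2782394 mod 6912675 ∷ 3052499 mod 6946875 ∷ 6180173 mod 6961185 ∷ 4703124 mod 6978125 ∷ []) ∷
  (4796168 mod 6979707 ∷ 3904074 mod 7025375 ∷ 1043198 mod 7026831 ∷ 5920199 mod 7063875 ∷ []) ∷
  (3461874 mod 7065625 ∷ 2116124 mod 7105725 ∷ 6765624 mod 7109375 ∷ 6067499 mod 7115625 ∷ []) ∷
  (2158474 mod 7132125 ∷ 55079 mod 7142499 ∷ 7144928 mod 7144929 ∷ 4255172 mod 7193043 ∷ []) ∷
  (4034744 mod 7194825 ∷ 3238948 mod 7210203 ∷ 4215374 mod 7239375 ∷ 4498658 mod 7249905 ∷ []) ∷
  (3697539 mod 7263025 ∷ 1640624 mod 7265625 ∷ 605069 mod 7271775 ∷ 3764767 mod 7311045 ∷ []) ∷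
  (713624 mod 7363125 ∷ 516214 mod 7383075 ∷ 3828124 mod 7421875 ∷ 3126599 mod 7502625 ∷ []) ∷
  (2143063 mod 7527135 ∷ 3576824 mod 7536375 ∷ 6181249 mod 7546875 ∷ 2526124 mod 7564375 ∷ []) ∷
  (6449462 mod 7577955 ∷ 1402499 mod 7596875 ∷ 1380482 mod 7628985 ∷ 545849 mod 7630875 ∷ []) ∷
  (5277397 mod 7647185 ∷ 553310 mod 7674183 ∷ 7351874 mod 7678125 ∷ 4207949 mod 7684875 ∷ []) ∷
  (4981339 mod 7691775 ∷ 2367683 mod 7702695 ∷ 374999 mod 7734375 ∷ 5734749 mod 7748125 ∷ []) ∷
  (6551522 mod 7770411 ∷ 2502499 mod 7809375 ∷ 3008452 mod 7815255 ∷ 6203789 mod 7818525 ∷ []) ∷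
  (756293 mod 7834365 ∷ 2401325 mod 7853517 ∷ 5518624 mod 7873125 ∷ 3114824 mod 7882875 ∷ []) ∷
  (1409043 mod 7896889 ∷ 6256249 mod 7940625 ∷ 3403619 mod 7952175 ∷ 1062881 mod 7971615 ∷ []) ∷
  (350349 mod 8017625 ∷ 1151324 mod 8056125 ∷ 2366333 mod 8102835 ∷ 2201716 mod 8117781 ∷ []) ∷
  (2947832 mod 8139285 ∷ 6442874 mod 8150625 ∷ 3080069 mod 8169525 ∷ 8046874 mod 8203125 ∷ []) ∷
  (4123349 mod 8204625 ∷ 6227164 mod 8206275 ∷ 3559874 mod 8229375 ∷ 5042978 mod 8241345 ∷ []) ∷
  (1769282 mod 8299665 ∷ 2278744 mod 8309175 ∷ 4377218 mod 8387379 ∷ 5533124 mod 8409375 ∷ []) ∷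
  (3405158 mod 8444007 ∷ 6318124 mod 8490625 ∷ 3020219 mod 8502975 ∷ 2967677 mod 8513505 ∷ []) ∷
  (7213975 mod 8530753 ∷ 3956282 mod 8562105 ∷ 1699564 mod 8583575 ∷ 3416093 mod 8588349 ∷ []) ∷
  (7077608 mod 8659035 ∷ 2156867 mod 8700615 ∷ 927499 mod 8728125 ∷ 6607457 mod 8729721 ∷ []) ∷
  (2028124 mod 8765625 ∷ 4133149 mod 8772225 ∷ 8160998 mod 8794863 ∷ 6203789 mod 8802675 ∷ []) ∷
  (6770708 mod 8860995 ∷ 6544394 mod 8887725 ∷ 6392833 mod 8895705 ∷ 5760557 mod 8955765 ∷ []) ∷
  (687224 mod 8960875 ∷ 234374 mod 8984375 ∷ 2657204 mod 9034497 ∷ 1474199 mod 9082125 ∷ []) ∷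
  (7018124 mod 9084375 ∷ 1921874 mod 9140625 ∷ 944124 mod 9156875 ∷ 262349 mod 9169875 ∷ []) ∷
  (130490 mod 9183213 ∷ 729364 mod 9273495 ∷ 4749999 mod 9296875 ∷ 9290599 mod 9326625 ∷ []) ∷
  (876874 mod 9384375 ∷ 2007235 mod 9428727 ∷ 6249999 mod 9453125 ∷ 4529249 mod 9466875 ∷ []) ∷
  (7892882 mod 9506889 ∷ 5009374 mod 9515625 ∷ 4846874 mod 9590625 ∷ 1467476 mod 9598743 ∷ []) ∷
  (5112953 mod 9677745 ∷ 7418624 mod 9725625 ∷ 7735418 mod 9743085 ∷ 1953124 mod 9765625 ∷ []) ∷
  (2028124 mod 9796875 ∷ 4065632 mod 9808695 ∷ 6194474 mod 9811125 ∷ 9638299 mod 9835525 ∷ []) ∷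
  (9795239 mod 9889425 ∷ 1362374 mod 9891875 ∷ 1558358 mod 9903465 ∷ 5989444 mod 9984975 ∷ []) ∷
  (7344658 mod 10000165 ∷ 9089999 mod 10040625 ∷ 1182653 mod 10072755 ∷ 6484071 mod 10081799 ∷ []) ∷
  (8959949 mod 10135125 ∷ 7733231 mod 10149867 ∷ 3139772 mod 10153143 ∷ 1327752 mod 10168235 ∷ []) ∷
  (6187499 mod 10209375 ∷ 4049594 mod 10224225 ∷ 6995624 mod 10278125 ∷ 6481249 mod 10359375 ∷ []) ∷
  (9359374 mod 10390625 ∷ 137444 mod 10392525 ∷ 7147874 mod 10443125 ∷ 675782 mod 10464795 ∷ []) ∷
  (1848769 mod 10470075 ∷ 2802194 mod 10503675 ∷ 8345875 mod 10537989 ∷ 7345624 mod 10565625 ∷ []) ∷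
  (6756749 mod 10580625 ∷ 8404724 mod 10590125 ∷ 7188668 mod 10596015 ∷ 7479044 mod 10683225 ∷ []) ∷
  (410227 mod 10768485 ∷ 725570 mod 10783773 ∷ 10134374 mod 10828125 ∷ 8081324 mod 10847375 ∷ []) ∷
  (588244 mod 10941357 ∷ 10149137 mod 10945935 ∷ 2441669 mod 10968111 ∷ 7186199 mod 11039875 ∷ []) ∷
  (866051 mod 11042163 ∷ 9430199 mod 11100375 ∷ 130624 mod 11103125 ∷ 7815499 mod 11116875 ∷ []) ∷
  (3130973 mod 11133045 ∷ 6898072 mod 11143041 ∷ 9656249 mod 11171875 ∷ 7596763 mod 11176655 ∷ []) ∷
  (4934249 mod 11188125 ∷ 1580624 mod 11221875 ∷ 2903768 mod 11223927 ∷ 2320394 mod 11224675 ∷ []) ∷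
  (6048314 mod 11278575 ∷ 8203124 mod 11328125 ∷ 2615651 mod 11343969 ∷ 5853869 mod 11427075 ∷ []) ∷
  (2519873 mod 11437335 ∷ 11003782 mod 11488785 ∷ 9861182 mod 11514555 ∷ []) ∷
  (8918749 mod 11578125 ∷ 4800464 mod 11619531 ∷ 3655693 mod 11632845 ∷ 4028453 mod 11711385 ∷ []) ∷
  (3251624 mod 11773125 ∷ 5138099 mod 11842875 ∷ 1165624 mod 11859375 ∷ 9912374 mod 11886875 ∷ []) ∷
  [])

table₅ : List (ℕ × ℕ)
table₅ = concat (
  (4428674 mod 11908215 ∷ 1781249 mod 11953125 ∷ 9815012 mod 11988405 ∷ 3714974 mod 11991375 ∷ []) ∷
  (10871727 mod 12017005 ∷ 10811249 mod 12065625 ∷ 5143094 mod 12083175 ∷ []) ∷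
  (7265624 mod 12109375 ∷ 1368124 mod 12271875 ∷ 8266642 mod 12281115 ∷ 2165129 mod 12341241 ∷ []) ∷
  (10708928 mod 12442815 ∷ 4463458 mod 12453987 ∷ 2959874 mod 12504375 ∷ []) ∷
  (10620994 mod 12545225 ∷ 10980374 mod 12560625 ∷ 8171874 mod 12578125 ∷ []) ∷
  (2058614 mod 12714975 ∷ 11907374 mod 12718125 ∷ 3238948 mod 12756513 ∷ []) ∷
  (4076324 mod 12790305 ∷ 7181249 mod 12796875 ∷ 1987874 mod 12808125 ∷ 1258074 mod 12819625 ∷ []) ∷
  (5106419 mod 12837825 ∷ 10859374 mod 12890625 ∷ 8735363 mod 12950685 ∷ []) ∷
  (10535783 mod 12962313 ∷ 2333428 mod 12982893 ∷ 12380606 mod 13049829 ∷ []) ∷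
  (100736 mod 13054041 ∷ 2149069 mod 13057275 ∷ 5157347 mod 13073445 ∷ 8555543 mod 13089195 ∷ []) ∷
  (730624 mod 13121875 ∷ 11172874 mod 13138125 ∷ 9515624 mod 13234375 ∷ 7291349 mod 13253625 ∷ []) ∷
  (4195624 mod 13321875 ∷ 9515624 mod 13359375 ∷ 10829294 mod 13504725 ∷ 907577 mod 13529635 ∷ []) ∷
  (12216014 mod 13565475 ∷ 2458124 mod 13584375 ∷ 6495389 mod 13640319 ∷ []) ∷
  (5078124 mod 13671875 ∷ 4487999 mod 13674375 ∷ 9411874 mod 13715625 ∷ 4321511 mod 13732173 ∷ []) ∷
  (5226119 mod 13735575 ∷ 3798089 mod 13832775 ∷ 4878782 mod 13845195 ∷ 9219349 mod 13848625 ∷ []) ∷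
  (6594290 mod 13864851 ∷ 7244698 mod 13978965 ∷ 7962499 mod 14015625 ∷ []) ∷
  (12354362 mod 14073345 ∷ 725570 mod 14101857 ∷ 5098724 mod 14171625 ∷ 1882383 mod 14235529 ∷ []) ∷
  (9939914 mod 14270175 ∷ 9871388 mod 14313915 ∷ 4782968 mod 14348907 ∷ 6209124 mod 14389375 ∷ []) ∷
  (12380606 mod 14585103 ∷ 10140624 mod 14609375 ∷ 13942949 mod 14620375 ∷ []) ∷
  (13707308 mod 14658105 ∷ 8744273 mod 14705145 ∷ 11890394 mod 14768325 ∷ []) ∷
  (6155477 mod 14771295 ∷ 14642099 mod 14812875 ∷ 416744 mod 14826175 ∷ []) ∷
  (11571416 mod 14834421 ∷ 7951931 mod 14939397 ∷ 12406249 mod 14953125 ∷ []) ∷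
  (5159258 mod 14956515 ∷ 3527068 mod 15075879 ∷ 14390999 mod 15136875 ∷ []) ∷
  (5403124 mod 15140625 ∷ 14527764 mod 15186325 ∷ 13906249 mod 15234375 ∷ []) ∷
  (466124 mod 15283125 ∷ 7328393 mod 15305355 ∷ 7457162 mod 15450435 ∷ 3486349 mod 15455825 ∷ []) ∷
  (2597374 mod 15544375 ∷ 2924074 mod 15563625 ∷ 5978124 mod 15640625 ∷ []) ∷
  (14763748 mod 15714545 ∷ 2846249 mod 15778125 ∷ 5044157 mod 15790005 ∷ []) ∷
  (9538682 mod 15842827 ∷ 4677992 mod 15844815 ∷ 3718749 mod 15859375 ∷ []) ∷
  (11860100 mod 15949791 ∷ 15468749 mod 15984375 ∷ 9269963 mod 15997905 ∷ []) ∷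
  (9684035 mod 16120377 ∷ 8953124 mod 16171875 ∷ 1799374 mod 16209375 ∷ 2755619 mod 16238475 ∷ []) ∷
  (14850184 mod 16242765 ∷ 12883765 mod 16285983 ∷ 7562499 mod 16328125 ∷ []) ∷
  (2321864 mod 16347825 ∷ 16223624 mod 16351875 ∷ 12871949 mod 16482375 ∷ []) ∷
  (11021669 mod 16505775 ∷ 9368974 mod 16641625 ∷ 13092974 mod 16665831 ∷ []) ∷
  (1949999 mod 16734375 ∷ 16174079 mod 16783767 ∷ 11031569 mod 16787925 ∷ []) ∷
  (5378239 mod 16823807 ∷ 11887874 mod 16891875 ∷ 7968749 mod 17015625 ∷ []) ∷
  (11411952 mod 17059105 ∷ 3976874 mod 17128125 ∷ 7959874 mod 17180625 ∷ []) ∷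
  (5176555 mod 17193561 ∷ 12484374 mod 17265625 ∷ 1061224 mod 17320875 ∷ []) ∷
  (9119789 mod 17441325 ∷ 4436099 mod 17506125 ∷ 15411788 mod 17537553 ∷ []) ∷
  (5387843 mod 17563315 ∷ 9343124 mod 17634375 ∷ 5117579 mod 17655651 ∷ []) ∷
  (13781744 mod 17660025 ∷ 169532 mod 17800965 ∷ 6230762 mod 17826237 ∷ 379014 mod 17947475 ∷ []) ∷
  (11048498 mod 17972955 ∷ 12781249 mod 18046875 ∷ 14059979 mod 18130959 ∷ []) ∷
  (9058972 mod 18235595 ∷ 7473464 mod 18243225 ∷ 16922443 mod 18280185 ∷ []) ∷
  (11247949 mod 18393375 ∷ 7866638 mod 18403605 ∷ 8443499 mod 18500625 ∷ []) ∷
  (11525489 mod 18644175 ∷ 8414999 mod 18646875 ∷ 16293749 mod 18703125 ∷ []) ∷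
  (15656948 mod 18706545 ∷ 18068993 mod 18836631 ∷ 459962 mod 18846135 ∷ []) ∷
  (15546653 mod 18906615 ∷ 2448872 mod 18991665 ∷ 13089194 mod 19072827 ∷ []) ∷
  (13961814 mod 19147975 ∷ 5649874 mod 19201875 ∷ 6481943 mod 19229805 ∷ []) ∷
  (2328124 mod 19296875 ∷ 3838169 mod 19388075 ∷ 10571602 mod 19412085 ∷ []) ∷
  (5708548 mod 19570551 ∷ 6914374 mod 19621875 ∷ 14736005 mod 19702683 ∷ []) ∷
  (18249999 mod 19765625 ∷ 14313914 mod 19847025 ∷ 13203124 mod 19921875 ∷ []) ∷
  (3954014 mod 19980675 ∷ 15439874 mod 19985625 ∷ 10274999 mod 20109375 ∷ []) ∷
  (12951574 mod 20145125 ∷ 9689063 mod 20204415 ∷ 7300292 mod 20369349 ∷ []) ∷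
  (10746917 mod 20371905 ∷ 13593749 mod 20390625 ∷ 6324999 mod 20453125 ∷ []) ∷
  (5701508 mod 20568735 ∷ 15943229 mod 20726199 ∷ 2026443 mod 20756645 ∷ 736874 mod 20840625 ∷ []) ∷
  (11443508 mod 20883555 ∷ 6387499 mod 20934375 ∷ 18524449 mod 21076125 ∷ []) ∷
  (15338699 mod 21191625 ∷ 19255624 mod 21196875 ∷ 14701322 mod 21260855 ∷ []) ∷
  (16572599 mod 21317175 ∷ 17703124 mod 21328125 ∷ 10811249 mod 21346875 ∷ []) ∷
  (11667974 mod 21396375 ∷ 19101743 mod 21427497 ∷ 8325908 mod 21434787 ∷ []) ∷
  (19140624 mod 21484375 ∷ 21038939 mod 21579129 ∷ 13627844 mod 21584475 ∷ []) ∷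
  (6076244 mod 21638155 ∷ 14165198 mod 21749715 ∷ 5528599 mod 21762125 ∷ []) ∷
  (6998914 mod 21789075 ∷ 19218749 mod 21796875 ∷ 258124 mod 21896875 ∷ []) ∷
  (16638929 mod 22000363 ∷ 10531124 mod 22089375 ∷ 312499 mod 22265625 ∷ []) ∷
  (19706378 mod 22581405 ∷ 20988449 mod 22609125 ∷ 3665624 mod 22640625 ∷ []) ∷
  (780499 mod 22693125 ∷ 1397492 mod 22733865 ∷ 233749 mod 22790625 ∷ 3059374 mod 22859375 ∷ []) ∷
  (19181447 mod 22886955 ∷ 3089474 mod 22892625 ∷ 3512662 mod 22941555 ∷ []) ∷
  (19077200 mod 23022549 ∷ 4935248 mod 23108085 ∷ 4233844 mod 23298275 ∷ []) ∷
  (16912070 mod 23311233 ∷ 5281249 mod 23359375 ∷ 13813568 mod 23503095 ∷ []) ∷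
  (18640499 mod 23619375 ∷ 16516135 mod 23690667 ∷ 18178124 mod 23821875 ∷ []) ∷
  (21958694 mod 23856525 ∷ 22320521 mod 23914845 ∷ 13555849 mod 24052875 ∷ []) ∷
  (7768223 mod 24308505 ∷ 19015919 mod 24430175 ∷ 2773154 mod 24588641 ∷ []) ∷
  (1388474 mod 24613875 ∷ 9046124 mod 24688125 ∷ 24272783 mod 24724035 ∷ []) ∷
  (15602057 mod 24898995 ∷ 8593749 mod 24921875 ∷ 20787857 mod 25126465 ∷ []) ∷
  (18356183 mod 25162137 ∷ 25154999 mod 25228125 ∷ 4749999 mod 25234375 ∷ []) ∷
  (17478503 mod 25332021 ∷ 7031249 mod 25390625 ∷ 8277499 mod 25471875 ∷ []) ∷
  (8688869 mod 25508925 ∷ 13235683 mod 25592259 ∷ 12223142 mod 25686315 ∷ []) ∷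
  (3680389 mod 25750725 ∷ 23455574 mod 25765047 ∷ 10285883 mod 26000429 ∷ []) ∷
  (18247085 mod 26189163 ∷ 22481249 mod 26296875 ∷ 21539033 mod 26582985 ∷ []) ∷
  (22343749 mod 26640625 ∷ 21357269 mod 26663175 ∷ 21219008 mod 26687115 ∷ []) ∷
  (6117747 mod 26807165 ∷ 11731067 mod 26867295 ∷ 20023849 mod 26882625 ∷ []) ∷
  (10390624 mod 26953125 ∷ 16512499 mod 27015625 ∷ 3097289 mod 27071275 ∷ []) ∷
  (9565937 mod 27103491 ∷ 22783088 mod 27143305 ∷ 19130624 mod 27253125 ∷ []) ∷
  (26424124 mod 27470625 ∷ 21658724 mod 27509625 ∷ 15435845 mod 27549639 ∷ []) ∷
  (10446874 mod 27671875 ∷ 23890624 mod 27890625 ∷ 24834974 mod 27979875 ∷ []) ∷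
  (22773749 mod 28153125 ∷ 18246864 mod 28203175 ∷ 7109374 mod 28359375 ∷ []) ∷
  (4723919 mod 28520667 ∷ 17661874 mod 28634375 ∷ 1663892 mod 28655935 ∷ []) ∷
  (7866638 mod 28796229 ∷ 2466749 mod 28868125 ∷ 19244014 mod 29059303 ∷ []) ∷
  (20386124 mod 29176875 ∷ 10983113 mod 29229255 ∷ 13671874 mod 29296875 ∷ []) ∷
  (8559374 mod 29390625 ∷ 7335197 mod 29426085 ∷ 14423149 mod 29506575 ∷ []) ∷
  (19982374 mod 29675625 ∷ 24666443 mod 29710395 ∷ 1495822 mod 29765197 ∷ []) ∷
  (12646094 mod 29954925 ∷ 3815188 mod 30000495 ∷ 8828124 mod 30078125 ∷ []) ∷
  (28043333 mod 30218265 ∷ 24321100 mod 30245397 ∷ 2203199 mod 30405375 ∷ []) ∷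
  (14499809 mod 30449601 ∷ 16677296 mod 30459429 ∷ 6026019 mod 30466975 ∷ []) ∷
  (5025292 mod 30504705 ∷ 19954999 mod 30834375 ∷ 23746874 mod 31078125 ∷ []) ∷
  (19203124 mod 31171875 ∷ 13994144 mod 31177575 ∷ 26686624 mod 31329375 ∷ []) ∷
  (17635967 mod 31394385 ∷ 6303419 mod 31511025 ∷ 26326474 mod 31770375 ∷ []) ∷
  (10720673 mod 31788045 ∷ 23436874 mod 32003125 ∷ 3999722 mod 32305455 ∷ []) ∷
  (18698525 mod 32351319 ∷ 23271863 mod 32617585 ∷ 1056249 mod 32703125 ∷ []) ∷
  (2851847 mod 32837805 ∷ 28033928 mod 32904333 ∷ 32846449 mod 33119625 ∷ []) ∷
  (11328124 mod 33203125 ∷ 5730074 mod 33301125 ∷ 11886874 mod 33309375 ∷ []) ∷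
  (16531249 mod 33515625 ∷ 23479378 mod 33529965 ∷ 17869004 mod 33671781 ∷ []) ∷
  (26750569 mod 33674025 ∷ 14843749 mod 33984375 ∷ 29084912 mod 34031907 ∷ []) ∷
  (12720497 mod 34466355 ∷ 2657204 mod 34543665 ∷ 12778124 mod 34734375 ∷ []) ∷
  (8673641 mod 34858593 ∷ 12884374 mod 34890625 ∷ 19166153 mod 34898535 ∷ []) ∷
  (19643633 mod 35134155 ∷ 18571734 mod 35177051 ∷ 22873499 mod 35319375 ∷ []) ∷
  (33137499 mod 35328125 ∷ 645974 mod 35528625 ∷ 9609374 mod 35546875 ∷ []) ∷
  (28837499 mod 35578125 ∷ 13569874 mod 35660625 ∷ 27162539 mod 35724645 ∷ []) ∷
  (5818877 mod 35965215 ∷ 35691974 mod 35974125 ∷ 14569267 mod 36051015 ∷ []) ∷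
  (9549374 mod 36815625 ∷ 17187499 mod 37109375 ∷ 6659344 mod 37635675 ∷ []) ∷
  (27312499 mod 37734375 ∷ 20680624 mod 37821875 ∷ 33309374 mod 37984375 ∷ []) ∷
  (21714643 mod 38000627 ∷ 10535264 mod 38144925 ∷ 20386124 mod 38154375 ∷ []) ∷
  (27545264 mod 38370915 ∷ 15749824 mod 38458875 ∷ 827144 mod 38513475 ∷ []) ∷
  (6562499 mod 38671875 ∷ 38276874 mod 38740625 ∷ 30319838 mod 38852055 ∷ []) ∷
  (6215012 mod 38886939 ∷ 17506124 mod 39162123 ∷ 19558769 mod 39171825 ∷ []) ∷
  (17281673 mod 39267585 ∷ 33861874 mod 39365625 ∷ 31623227 mod 39484445 ∷ []) ∷
  (21546874 mod 39703125 ∷ 16127099 mod 39760875 ∷ 20706223 mod 40118309 ∷ []) ∷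
  (5025292 mod 40588905 ∷ 897973 mod 40857817 ∷ 3124999 mod 41015625 ∷ 9046124 mod 41023125 ∷ []) ∷
  (268124 mod 41146875 ∷ 13476293 mod 41196519 ∷ 28118744 mod 41206725 ∷ []) ∷
  (23882599 mod 41545875 ∷ 15837524 mod 41594553 ∷ 39862283 mod 41936895 ∷ []) ∷
  (17306249 mod 42046875 ∷ 17045477 mod 42220035 ∷ 33629903 mod 42305571 ∷ []) ∷
  (19903124 mod 42453125 ∷ 9822599 mod 42514875 ∷ 10726638 mod 42653765 ∷ []) ∷
  (20000329 mod 42706587 ∷ 23718014 mod 42810525 ∷ 33727913 mod 42941745 ∷ []) ∷
  (14348906 mod 43046721 ∷ 21312499 mod 43828125 ∷ 737449 mod 43861125 ∷ []) ∷
  (35496383 mod 43974315 ∷ 31581494 mod 44304975 ∷ 4766849 mod 44438625 ∷ []) ∷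
  (43754794 mod 44478525 ∷ 6626609 mod 44503263 ∷ 42810524 mod 44818191 ∷ []) ∷
  (34374999 mod 44921875 ∷ 4251527 mod 45172485 ∷ 30637499 mod 45421875 ∷ []) ∷
  (29052099 mod 45664619 ∷ 22920624 mod 45784375 ∷ 25937999 mod 45849375 ∷ []) ∷
  (12430178 mod 45916065 ∷ 39828424 mod 46367475 ∷ 30781249 mod 46484375 ∷ []) ∷
  (41001124 mod 46633125 ∷ 8384374 mod 46921875 ∷ 36948988 mod 47143635 ∷ []) ∷
  [])

table₆ : List (ℕ × ℕ)
table₆ = concat (
  (32031249 mod 47265625 ∷ 30256225 mod 47528481 ∷ 9959597 mod 47534445 ∷ []) ∷
  (37624999 mod 47578125 ∷ 17176697 mod 47849373 ∷ 9796874 mod 47953125 ∷ []) ∷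
  (14602598 mod 47993715 ∷ 28814999 mod 48628125 ∷ 13581269 mod 48715425 ∷ []) ∷
  (9765624 mod 48828125 ∷ 45079999 mod 48846875 ∷ 47093749 mod 48984375 ∷ []) ∷
  (43398074 mod 49177625 ∷ 46864999 mod 49459375 ∷ 5519744 mod 49517325 ∷ []) ∷
  (43932349 mod 49924875 ∷ 40869359 mod 49997493 ∷ 21768668 mod 50351301 ∷ []) ∷
  (33415469 mod 50363775 ∷ 40319992 mod 50471421 ∷ 23149124 mod 50675625 ∷ []) ∷
  (2000032 mod 51177315 ∷ 2884374 mod 51390625 ∷ 41703124 mod 51796875 ∷ []) ∷
  (34296874 mod 51953125 ∷ 12608474 mod 51962625 ∷ 98414 mod 52323975 ∷ []) ∷
  (51119099 mod 52518375 ∷ 27103490 mod 52612659 ∷ 51607093 mod 52689945 ∷ []) ∷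
  (52199315 mod 52966953 ∷ 288683 mod 53478711 ∷ 45637864 mod 53842425 ∷ []) ∷
  (52985393 mod 53918865 ∷ 18796874 mod 54140625 ∷ 38234591 mod 54392877 ∷ []) ∷
  (7294237 mod 54706785 ∷ 1392389 mod 54729675 ∷ 10829048 mod 54840555 ∷ []) ∷
  (38539313 mod 55210815 ∷ 47662250 mod 55278223 ∷ 51611624 mod 55501875 ∷ []) ∷
  (26778124 mod 55515625 ∷ 18593749 mod 55859375 ∷ 46834523 mod 56119635 ∷ []) ∷
  (31709312 mod 56509893 ∷ 21484374 mod 56640625 ∷ 28151063 mod 56719845 ∷ []) ∷
  (1416589 mod 57443925 ∷ 11234374 mod 57890625 ∷ 12961969 mod 58164225 ∷ []) ∷
  (18755582 mod 58711653 ∷ 52698749 mod 58865625 ∷ 47573810 mod 59108049 ∷ []) ∷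
  (31999999 mod 59296875 ∷ 31308749 mod 59434375 ∷ 48813839 mod 59541075 ∷ []) ∷
  (48649061 mod 59715271 ∷ 50575589 mod 59942025 ∷ 42087374 mod 59956875 ∷ []) ∷
  (14090075 mod 61108047 ∷ 8731249 mod 61359375 ∷ 12557753 mod 61706205 ∷ []) ∷
  (38263751 mod 62178597 ∷ 48329728 mod 62269935 ∷ 13492499 mod 62803125 ∷ []) ∷
  (624999 mod 62890625 ∷ 22402574 mod 63574875 ∷ 47518124 mod 63590625 ∷ []) ∷
  (53249999 mod 63984375 ∷ 61592849 mod 64189125 ∷ 54814238 mod 64282491 ∷ []) ∷
  (35606546 mod 64304361 ∷ 28906249 mod 64453125 ∷ 49811111 mod 64737387 ∷ []) ∷
  (42407144 mod 64753425 ∷ 45843664 mod 64914465 ∷ 21415103 mod 65249145 ∷ []) ∷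
  (43932349 mod 65286375 ∷ 63715624 mod 65609375 ∷ 55842499 mod 65690625 ∷ []) ∷
  (45109987 mod 66001089 ∷ 55234374 mod 66171875 ∷ 17894249 mod 66268125 ∷ []) ∷
  (6789824 mod 67827375 ∷ 8975447 mod 68201595 ∷ 35156249 mod 68359375 ∷ []) ∷
  (15427499 mod 68371875 ∷ 6668749 mod 68578125 ∷ 49697387 mod 68660865 ∷ []) ∷
  (10720349 mod 68677875 ∷ 58854113 mod 69324255 ∷ 68752144 mod 69894825 ∷ []) ∷
  (1371248 mod 69933699 ∷ 38796874 mod 70078125 ∷ 52985393 mod 70509285 ∷ []) ∷
  (12245099 mod 70572593 ∷ 10767374 mod 70858125 ∷ 48103691 mod 71072001 ∷ []) ∷
  (67883472 mod 71177645 ∷ 29910869 mod 71569575 ∷ 38263751 mod 71744535 ∷ []) ∷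
  (17720624 mod 71946875 ∷ 48282398 mod 72925515 ∷ 33515624 mod 73046875 ∷ []) ∷
  (11752894 mod 73290525 ∷ 70068382 mod 73765923 ∷ 17797724 mod 73841625 ∷ []) ∷
  (50192999 mod 74064375 ∷ 32514128 mod 74172105 ∷ 7302392 mod 74696985 ∷ []) ∷
  (16015624 mod 74765625 ∷ 48099232 mod 75379395 ∷ 47796874 mod 75703125 ∷ []) ∷
  (35606546 mod 75996063 ∷ 38281249 mod 76171875 ∷ 67711874 mod 76415625 ∷ []) ∷
  (25694819 mod 76526775 ∷ 72950954 mod 76776777 ∷ 51942449 mod 77279125 ∷ []) ∷
  (32043923 mod 77295141 ∷ 67883749 mod 77721875 ∷ 48286510 mod 78001287 ∷ []) ∷
  (12234374 mod 78203125 ∷ 26976806 mod 78567489 ∷ 65844008 mod 79748955 ∷ []) ∷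
  (18046874 mod 79921875 ∷ 12469544 mod 79989525 ∷ 62505232 mod 80421495 ∷ []) ∷
  (2775302 mod 80601885 ∷ 60153124 mod 81046875 ∷ 67143964 mod 81213825 ∷ []) ∷
  (57395627 mod 81310473 ∷ 43539733 mod 81429915 ∷ 20624999 mod 81640625 ∷ []) ∷
  (30828599 mod 82528875 ∷ 6252632 mod 82648917 ∷ 65950499 mod 83208125 ∷ []) ∷
  (5296874 mod 83671875 ∷ 71468099 mod 83939625 ∷ 571437 mod 84119035 ∷ []) ∷
  (32158124 mod 84459375 ∷ 23437499 mod 85078125 ∷ 73246249 mod 85903125 ∷ []) ∷
  (84488788 mod 85967805 ∷ 15937499 mod 86328125 ∷ 84656582 mod 86388687 ∷ []) ∷
  (46095499 mod 86604375 ∷ 86303944 mod 87177909 ∷ 934874 mod 87530625 ∷ []) ∷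
  (79184708 mod 87687765 ∷ 46569977 mod 88278255 ∷ 4859513 mod 89131185 ∷ []) ∷
  (59732077 mod 89295591 ∷ 32616044 mod 89864775 ∷ 56093749 mod 90234375 ∷ []) ∷
  (48188843 mod 90654795 ∷ 14239301 mod 90736191 ∷ 4349942 mod 91348803 ∷ []) ∷
  (9610369 mod 91400925 ∷ 71345624 mod 92503125 ∷ 8812499 mod 93515625 ∷ []) ∷
  (86741819 mod 93532725 ∷ 86920127 mod 94183155 ∷ 79829144 mod 94533075 ∷ []) ∷
  (84892778 mod 95364135 ∷ 13330624 mod 96009375 ∷ 71796874 mod 96484375 ∷ []) ∷
  (13235683 mod 97852755 ∷ 57931249 mod 98109375 ∷ 79473392 mod 98513415 ∷ []) ∷
  (14296874 mod 98828125 ∷ 49955453 mod 99379467 ∷ 17187499 mod 99609375 ∷ []) ∷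
  (27930824 mod 99903375 ∷ 67402499 mod 99928125 ∷ 94734374 mod 100546875 ∷ []) ∷
  (41154749 mod 100725625 ∷ 29092931 mod 101015343 ∷ 35390624 mod 101953125 ∷ []) ∷
  (40428881 mod 102095721 ∷ 84046874 mod 102265625 ∷ 95659379 mod 103630995 ∷ []) ∷
  (20293172 mod 104575779 ∷ 99509374 mod 104671875 ∷ 65984281 mod 105531153 ∷ []) ∷
  (11100374 mod 105958125 ∷ 91324999 mod 105984375 ∷ 56093749 mod 106640625 ∷ []) ∷
  (37343624 mod 106981875 ∷ 23914844 mod 107173935 ∷ 66406249 mod 107421875 ∷ []) ∷
  (101726117 mod 107895645 ∷ 95648849 mod 107922375 ∷ 40347999 mod 108810625 ∷ []) ∷
  (95581408 mod 110001815 ∷ 107724374 mod 110446875 ∷ 91016078 mod 110899789 ∷ []) ∷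
  (58203124 mod 111328125 ∷ 39890624 mod 113203125 ∷ 64321249 mod 113465625 ∷ []) ∷
  (100512499 mod 113953125 ∷ 64068283 mod 114001881 ∷ 35062499 mod 114296875 ∷ []) ∷
  (74110139 mod 114434775 ∷ 7667999 mod 114463125 ∷ 50038559 mod 115112745 ∷ []) ∷
  (65016269 mod 115540425 ∷ 102086599 mod 116491375 ∷ 95073263 mod 116556165 ∷ []) ∷
  (112734374 mod 116796875 ∷ 32616044 mod 117515475 ∷ 46983749 mod 118096875 ∷ []) ∷
  (853124 mod 119109375 ∷ 36235891 mod 120354927 ∷ 88186328 mod 122943205 ∷ []) ∷
  (104766749 mod 123069375 ∷ 13983749 mod 123440625 ∷ 123333677 mod 123589557 ∷ []) ∷
  (14383169 mod 123620175 ∷ 12890624 mod 124609375 ∷ 1972673 mod 124783659 ∷ []) ∷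
  (95778143 mod 125810685 ∷ 90546874 mod 126171875 ∷ 31118822 mod 126660105 ∷ []) ∷
  (103515624 mod 126953125 ∷ 13371874 mod 127359375 ∷ 23994224 mod 127544625 ∷ []) ∷
  (50871358 mod 127961295 ∷ 105297488 mod 128825235 ∷ 43046720 mod 129140163 ∷ []) ∷
  (6703124 mod 131484375 ∷ 90654794 mod 132914925 ∷ 36295451 mod 133509789 ∷ []) ∷
  (26562499 mod 134765625 ∷ 65140624 mod 135078125 ∷ 81310472 mod 135517455 ∷ []) ∷
  (125927647 mod 136993857 ∷ 20929999 mod 137353125 ∷ 10654874 mod 137548125 ∷ []) ∷
  (73651598 mod 137748195 ∷ 49187499 mod 138359375 ∷ 96406249 mod 139453125 ∷ []) ∷
  (103178624 mod 139899375 ∷ 39665624 mod 140765625 ∷ 136700199 mod 141015875 ∷ []) ∷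
  (105078124 mod 141796875 ∷ 141156014 mod 142585443 ∷ 25804412 mod 142603335 ∷ []) ∷
  (128825234 mod 143548119 ∷ 30600503 mod 143981145 ∷ 141033749 mod 144340625 ∷ []) ∷
  (108774903 mod 145296515 ∷ 61233749 mod 145884375 ∷ 19531249 mod 146484375 ∷ []) ∷
  (125929999 mod 146540625 ∷ 14437499 mod 146953125 ∷ 55593124 mod 148378125 ∷ []) ∷
  (137565944 mod 148551975 ∷ 117968332 mod 148825985 ∷ 14843749 mod 150390625 ∷ []) ∷
  (139255037 mod 151053903 ∷ 100567169 mod 151091325 ∷ 30399599 mod 152334875 ∷ []) ∷
  (87790624 mod 154171875 ∷ 110765624 mod 155390625 ∷ 75312499 mod 155859375 ∷ []) ∷
  (151175474 mod 155887875 ∷ 48813839 mod 156971925 ∷ 9565937 mod 157837977 ∷ []) ∷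
  (35941157 mod 160436133 ∷ 70958348 mod 161756595 ∷ 140695169 mod 163087925 ∷ []) ∷
  (1972673 mod 163178631 ∷ 92624999 mod 163515625 ∷ 47389418 mod 164521665 ∷ []) ∷
  (165428899 mod 165834669 ∷ 164062499 mod 166015625 ∷ 125614124 mod 166505625 ∷ []) ∷
  (105153124 mod 166546875 ∷ 70156249 mod 167578125 ∷ 140367248 mod 168358905 ∷ []) ∷
  (66406249 mod 169921875 ∷ 9244448 mod 170159535 ∷ 165609374 mod 173671875 ∷ []) ∷
  (78219777 mod 175885255 ∷ 72320624 mod 176596875 ∷ 75531249 mod 176640625 ∷ []) ∷
  (146087225 mod 177324147 ∷ 94921874 mod 177734375 ∷ 71531249 mod 177890625 ∷ []) ∷
  (177608749 mod 178303125 ∷ 157070339 mod 178623225 ∷ 20547757 mod 179145813 ∷ []) ∷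
  (70556264 mod 179826075 ∷ 122029874 mod 179870625 ∷ 156675518 mod 183324141 ∷ []) ∷
  (90543749 mod 184078125 ∷ 46874999 mod 185546875 ∷ 114791255 mod 186535791 ∷ []) ∷
  (38471222 mod 187650155 ∷ 19765624 mod 188671875 ∷ 78890624 mod 189921875 ∷ []) ∷
  (30538318 mod 190003135 ∷ 5124374 mod 190771875 ∷ 31514669 mod 191854575 ∷ []) ∷
  (147178349 mod 192567375 ∷ 33386741 mod 192847473 ∷ 6652853 mod 194212161 ∷ []) ∷
  (193498469 mod 194260275 ∷ 57481249 mod 196828125 ∷ 94798339 mod 197422225 ∷ []) ∷
  (79296874 mod 198515625 ∷ 163061513 mod 200591545 ∷ 142578124 mod 205078125 ∷ []) ∷
  (197752499 mod 205115625 ∷ 189543749 mod 205734375 ∷ 72584342 mod 205982595 ∷ []) ∷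
  (12637943 mod 207972765 ∷ 164549879 mod 209801097 ∷ 202312499 mod 210234375 ∷ []) ∷
  (170500868 mod 211527855 ∷ 50245726 mod 211717779 ∷ 45374999 mod 212265625 ∷ []) ∷
  (128864249 mod 212574375 ∷ 27788144 mod 213268825 ∷ 171414592 mod 213532935 ∷ []) ∷
  (157837976 mod 215233605 ∷ 205390624 mod 219140625 ∷ 205582373 mod 222516315 ∷ []) ∷
  (206494352 mod 224090955 ∷ 25390624 mod 224609375 ∷ 148734374 mod 227109375 ∷ []) ∷
  (23914844 mod 227988189 ∷ 97826343 mod 228323095 ∷ 16768124 mod 229246875 ∷ []) ∷
  (76712669 mod 229580325 ∷ 67968749 mod 232421875 ∷ 13021249 mod 233165625 ∷ []) ∷
  (186687499 mod 234609375 ∷ 210300947 mod 235702467 ∷ 23437499 mod 236328125 ∷ []) ∷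
  (39261023 mod 239246865 ∷ 90234374 mod 239765625 ∷ 87168749 mod 243140625 ∷ []) ∷
  -- 5^12 with residue 5^11 - 1, the last pure power of 5.
  (100442348 mod 243931419 ∷ 48828124 mod 244140625 ∷ 76484374 mod 244921875 ∷ []) ∷
  (144000827 mod 247946751 ∷ 33947374 mod 249624375 ∷ 43488224 mod 251818875 ∷ []) ∷
  (220575067 mod 252357105 ∷ 33718749 mod 256953125 ∷ 62421874 mod 258984375 ∷ []) ∷
  (107031249 mod 259765625 ∷ 74963624 mod 259813125 ∷ 108413963 mod 263063295 ∷ []) ∷
  (252552572 mod 264834765 ∷ 123701093 mod 267393555 ∷ 108625373 mod 271964385 ∷ []) ∷
  (172639102 mod 276391115 ∷ 40511249 mod 277509375 ∷ 215531249 mod 277578125 ∷ []) ∷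
  (174999999 mod 279296875 ∷ 24386669 mod 280598175 ∷ 119397077 mod 282549465 ∷ []) ∷
  (39062499 mod 283203125 ∷ 94287269 mod 286004719 ∷ 138593749 mod 289453125 ∷ []) ∷
  (45853268 mod 293558265 ∷ 123337499 mod 294328125 ∷ 13797782 mod 295540245 ∷ []) ∷
  (186171874 mod 296484375 ∷ 78856249 mod 297171875 ∷ 161026622 mod 298138401 ∷ []) ∷
  (291022808 mod 298576355 ∷ 233949374 mod 299784375 ∷ 163780055 mod 303046029 ∷ []) ∷
  (168265624 mod 306796875 ∷ 310892984 mod 310892985 ∷ 159727544 mod 313727337 ∷ []) ∷
  (151562499 mod 314453125 ∷ 161981249 mod 317953125 ∷ 139951888 mod 319652333 ∷ []) ∷
  [])

table₇ : List (ℕ × ℕ)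
table₇ = concat (
  (215646749 mod 320945625 ∷ 14171759 mod 321521805 ∷ 183593749 mod 322265625 ∷ []) ∷
  (173656547 mod 323686935 ∷ 187562374 mod 326431875 ∷ 313031249 mod 328046875 ∷ []) ∷
  (212053918 mod 330005445 ∷ 133437499 mod 330859375 ∷ 159262102 mod 332699367 ∷ []) ∷
  (322265624 mod 341796875 ∷ 138496874 mod 341859375 ∷ 335843749 mod 342890625 ∷ []) ∷
  (142043219 mod 346621275 ∷ 236499724 mod 349474125 ∷ 289333538 mod 349668495 ∷ []) ∷
  (122890624 mod 350390625 ∷ 322543124 mod 354290625 ∷ 291118749 mod 359734375 ∷ []) ∷
  (296484374 mod 365234375 ∷ 81715633 mod 368829615 ∷ 82137158 mod 370768671 ∷ []) ∷
  (326562499 mod 373828125 ∷ 85161779 mod 374350977 ∷ 335468749 mod 378515625 ∷ []) ∷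
  (316207394 mod 379980315 ∷ 83984374 mod 380859375 ∷ 98278124 mod 382078125 ∷ []) ∷
  (136178888 mod 383883885 ∷ 191180978 mod 386475705 ∷ 95043584 mod 386947561 ∷ []) ∷
  (129140162 mod 387420489 ∷ 238871874 mod 388609375 ∷ 121718749 mod 391015625 ∷ []) ∷
  (189828124 mod 405234375 ∷ 200884697 mod 406552365 ∷ 167578124 mod 408203125 ∷ []) ∷
  (119567663 mod 413244585 ∷ 99233749 mod 416040625 ∷ 99833579 mod 418006897 ∷ []) ∷
  (289711124 mod 419698125 ∷ 216796874 mod 425390625 ∷ 188684495 mod 427756329 ∷ []) ∷
  (378515624 mod 431640625 ∷ 366556508 mod 431943435 ∷ 357871249 mod 433021875 ∷ []) ∷
  (30538318 mod 435889545 ∷ 272656249 mod 451171875 ∷ 38552435 mod 453161709 ∷ []) ∷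
  (302022269 mod 453273975 ∷ 155851849 mod 457004625 ∷ 293353124 mod 462515625 ∷ []) ∷
  (255100724 mod 467663625 ∷ 243675539 mod 470915775 ∷ 114791255 mod 473513931 ∷ []) ∷
  (226171874 mod 482421875 ∷ 228511744 mod 489263775 ∷ 56365550 mod 489535893 ∷ []) ∷
  (313015624 mod 490546875 ∷ 193717481 mod 494008151 ∷ 389843749 mod 494140625 ∷ []) ∷
  (14880347 mod 496897335 ∷ 37109374 mod 498046875 ∷ 327215624 mod 499640625 ∷ []) ∷
  (182170624 mod 503628125 ∷ 252606518 mod 505076715 ∷ 122684138 mod 510478605 ∷ []) ∷
  (63593749 mod 511328125 ∷ 231163477 mod 527655765 ∷ 345687499 mod 529921875 ∷ []) ∷
  (354687499 mod 533203125 ∷ 58739999 mod 534909375 ∷ 59639489 mod 535869675 ∷ []) ∷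
  (87890624 mod 537109375 ∷ 323255624 mod 544053125 ∷ 217783565 mod 549972423 ∷ []) ∷
  (124999999 mod 556640625 ∷ 129140162 mod 559607373 ∷ 148473037 mod 562950465 ∷ []) ∷
  (487953124 mod 569765625 ∷ 567017758 mod 570009405 ∷ 80781249 mod 571484375 ∷ []) ∷
  (514458944 mod 575563725 ∷ 18800099 mod 577702125 ∷ 354799196 mod 578542419 ∷ []) ∷
  (23914844 mod 578739249 ∷ 459814562 mod 582636483 ∷ 182812499 mod 583984375 ∷ []) ∷
  (188699999 mod 590484375 ∷ 98354563 mod 601774635 ∷ 553210397 mod 617947785 ∷ []) ∷
  (279296874 mod 623046875 ∷ 289934963 mod 623918295 ∷ 267187499 mod 630859375 ∷ []) ∷
  (78124999 mod 634765625 ∷ 420921874 mod 636796875 ∷ 153240394 mod 639806475 ∷ []) ∷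
  (86093441 mod 645700815 ∷ 279754478 mod 667548945 ∷ 376953124 mod 673828125 ∷ []) ∷
  (578437499 mod 675390625 ∷ 234365480 mod 683964567 ∷ 642289108 mod 684969285 ∷ []) ∷
  (104531249 mod 691796875 ∷ 40624999 mod 697265625 ∷ 634796249 mod 699496875 ∷ []) ∷
  (264890624 mod 703828125 ∷ 524570903 mod 707107401 ∷ 130859374 mod 708984375 ∷ []) ∷
  (438005798 mod 717740595 ∷ 689528124 mod 721703125 ∷ 387420488 mod 731794257 ∷ []) ∷
  (341796874 mod 732421875 ∷ 44921874 mod 751953125 ∷ 463186349 mod 755456625 ∷ []) ∷
  (581140624 mod 770859375 ∷ 772257639 mod 776298523 ∷ 667578124 mod 779296875 ∷ []) ∷
  (681194249 mod 779439375 ∷ 196101728 mod 789189885 ∷ 480225833 mod 802180665 ∷ []) ∷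
  (289934963 mod 815893155 ∷ 386953124 mod 817578125 ∷ 429687499 mod 830078125 ∷ []) ∷
  (738031249 mod 832734375 ∷ 3124999 mod 837890625 ∷ 679115744 mod 841794525 ∷ []) ∷
  (634765624 mod 849609375 ∷ 110859374 mod 883203125 ∷ 703391687 mod 886620735 ∷ []) ∷
  (699218749 mod 888671875 ∷ 284590624 mod 891515625 ∷ 827453636 mod 894415203 ∷ []) ∷
  (800358943 mod 895729065 ∷ 870887456 mod 909138087 ∷ 679593749 mod 920390625 ∷ []) ∷
  (380859374 mod 927734375 ∷ 645700814 mod 932678955 ∷ 548046874 mod 943359375 ∷ []) ∷
  (686640624 mod 949609375 ∷ 419485912 mod 958956999 ∷ 108664874 mod 962836875 ∷ []) ∷
  (129140162 mod 964565415 ∷ 65760902 mod 971060805 ∷ 372406249 mod 984140625 ∷ []) ∷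
  (935560625 mod 998098101 ∷ 224609374 mod 1025390625 ∷ 107249999 mod 1028671875 ∷ []) ∷
  (719745344 mod 1039863825 ∷ 522445868 mod 1049005485 ∷ 1021796874 mod 1061328125 ∷ []) ∷
  (468359374 mod 1095703125 ∷ 1103515624 mod 1123046875 ∷ 334729097 mod 1123052931 ∷ []) ∷
  (813104729 mod 1139940945 ∷ 212810233 mod 1160842683 ∷ 486328124 mod 1162109375 ∷ []) ∷
  -- 3^19 with residue 3^18 - 1, the last pure power of 3. The smaller the prime, the further its
  -- chain is carried.
  (387420488 mod 1162261467 ∷ 1038949999 mod 1165828125 ∷ 843593749 mod 1173046875 ∷ []) ∷
  (947265624 mod 1181640625 ∷ 865218749 mod 1215703125 ∷ 1205308187 mod 1219657095 ∷ []) ∷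
  (468359374 mod 1224609375 ∷ 257315858 mod 1239733755 ∷ 483271249 mod 1248121875 ∷ []) ∷
  (788315527 mod 1254020691 ∷ 849308624 mod 1259094375 ∷ 701796874 mod 1284765625 ∷ []) ∷
  (942968749 mod 1294921875 ∷ 730468749 mod 1298828125 ∷ 646552499 mod 1299065625 ∷ []) ∷
  (1095929756 mod 1359485127 ∷ 1359661544 mod 1359821925 ∷ 1159296874 mod 1387890625 ∷ []) ∷
  (1236328124 mod 1396484375 ∷ 1034540099 mod 1402990875 ∷ 976562499 mod 1416015625 ∷ []) ∷
  (1377495071 mod 1420541793 ∷ 485937499 mod 1447265625 ∷ 1198615967 mod 1468607679 ∷ []) ∷
  (476531249 mod 1471640625 ∷ 231718108 mod 1482024453 ∷ 67578124 mod 1482421875 ∷ []) ∷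
  (1208109374 mod 1485859375 ∷ 1388655332 mod 1490692005 ∷ 84247613 mod 1515230145 ∷ []) ∷
  (965937499 mod 1533984375 ∷ 591796874 mod 1572265625 ∷ 1052249999 mod 1589765625 ∷ []) ∷
  (1304676988 mod 1598261665 ∷ 1306861874 mod 1604728125 ∷ 1601562499 mod 1611328125 ∷ []) ∷
  (579280624 mod 1632159375 ∷ 1231562499 mod 1640234375 ∷ 516560651 mod 1678822119 ∷ []) ∷
  (1437562499 mod 1709296875 ∷ 953046874 mod 1714453125 ∷ 161951723 mod 1735627257 ∷ []) ∷
  (918330047 mod 1736217747 ∷ 893749999 mod 1751953125 ∷ 938640624 mod 1798671875 ∷ []) ∷
  (515624999 mod 1826171875 ∷ 759192992 mod 1853843355 ∷ 365234374 mod 1869140625 ∷ []) ∷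
  (1121826023 mod 1871754885 ∷ 638281249 mod 1892578125 ∷ 1835937499 mod 1904296875 ∷ []) ∷
  (633187499 mod 1910390625 ∷ 330576882 mod 1934737805 ∷ 1807962281 mod 1937102445 ∷ []) ∷
  (1093812499 mod 1943046875 ∷ 669140624 mod 1955078125 ∷ 838203124 mod 2026171875 ∷ []) ∷
  (85937499 mod 2041015625 ∷ 1865357909 mod 2051893701 ∷ 1058790578 mod 2090034485 ∷ []) ∷
  (1800624374 mod 2098490625 ∷ 760273370 mod 2121322203 ∷ 896484374 mod 2158203125 ∷ []) ∷
  (617684374 mod 2165109375 ∷ 1162261466 mod 2195382771 ∷ 904296874 mod 2255859375 ∷ []) ∷
  (1865906249 mod 2312578125 ∷ 1727701975 mod 2328895569 ∷ 161567999 mod 2338318125 ∷ []) ∷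
  (459165023 mod 2367569655 ∷ 515624999 mod 2412109375 ∷ 833863733 mod 2447679465 ∷ []) ∷
  (1097890624 mod 2452734375 ∷ 1773437499 mod 2470703125 ∷ 136718749 mod 2490234375 ∷ []) ∷
  (2125921874 mod 2498203125 ∷ 959713919 mod 2525383575 ∷ 983984374 mod 2556640625 ∷ []) ∷
  (1617499999 mod 2649609375 ∷ 1314453124 mod 2666015625 ∷ 1770449999 mod 2674546875 ∷ []) ∷
  (1248354908 mod 2683245609 ∷ 195312499 mod 2685546875 ∷ 1173933485 mod 2727414261 ∷ []) ∷
  (1015624999 mod 2783203125 ∷ 1855390624 mod 2848828125 ∷ 2595312499 mod 2857421875 ∷ []) ∷
  (2759773112 mod 2893696245 ∷ 713134772 mod 2913182415 ∷ 533203124 mod 2919921875 ∷ []) ∷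
  (2668734374 mod 2952421875 ∷ 107421874 mod 3115234375 ∷ 1150390624 mod 3154296875 ∷ []) ∷
  (1185078124 mod 3183984375 ∷ 2128906249 mod 3369140625 ∷ 1118749999 mod 3376953125 ∷ []) ∷
  (550041434 mod 3419822835 ∷ 1764843749 mod 3458984375 ∷ 1853515624 mod 3486328125 ∷ []) ∷
  (2593387499 mod 3497484375 ∷ 3417968749 mod 3544921875 ∷ 2710296874 mod 3608515625 ∷ []) ∷
  (3142410632 mod 3658971285 ∷ 3203124999 mod 3759765625 ∷ 3047890624 mod 3854296875 ∷ []) ∷
  (2849609374 mod 3896484375 ∷ 213530624 mod 3897196875 ∷ 1549091465 mod 4078455381 ∷ []) ∷
  (1858593749 mod 4087890625 ∷ 1404218749 mod 4163671875 ∷ 1343749999 mod 4189453125 ∷ []) ∷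
  (2832031249 mod 4248046875 ∷ 3745064726 mod 4261625379 ∷ 2937109374 mod 4416015625 ∷ []) ∷
  (1054687499 mod 4443359375 ∷ 3494046874 mod 4457578125 ∷ 1037904272 mod 4472076015 ∷ []) ∷
  (4124861333 mod 4545690435 ∷ 3189453124 mod 4716796875 ∷ 876562499 mod 4748046875 ∷ []) ∷
  (935847373 mod 4794784995 ∷ 2931171874 mod 4920703125 ∷ 4261625378 mod 5036466357 ∷ []) ∷
  (4864279472 mod 5208653241 ∷ 597265624 mod 5306640625 ∷ 2435754474 mod 5434089661 ∷ []) ∷
  (2878906249 mod 5478515625 ∷ 3617499203 mod 5615264655 ∷ 2578124999 mod 5810546875 ∷ []) ∷
  (3099363911 mod 5811307335 ∷ 3836937499 mod 5829140625 ∷ 4128124999 mod 5865234375 ∷ []) ∷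
  (2343749999 mod 5908203125 ∷ 6101562499 mod 6123046875 ∷ 2798036864 mod 6155681103 ∷ []) ∷
  (4255313908 mod 6270103455 ∷ 1467380771 mod 6363966609 ∷ 4042187499 mod 6423828125 ∷ []) ∷
  (4050781249 mod 6474609375 ∷ 3847656249 mod 6494140625 ∷ 3504496874 mod 6495328125 ∷ []) ∷
  (1937102444 mod 6586148313 ∷ 1714453124 mod 6939453125 ∷ 957031249 mod 6982421875 ∷ []) ∷
  (2929687499 mod 7080078125 ∷ 1248354908 mod 7102708965 ∷ 3669921874 mod 7236328125 ∷ []) ∷
  (4913329508 mod 7343038395 ∷ 3921874999 mod 7412109375 ∷ 2396796874 mod 7429296875 ∷ []) ∷
  (1886328124 mod 7669921875 ∷ 5937499999 mod 7861328125 ∷ 7877549942 mod 8049736827 ∷ []) ∷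
  (3857421874 mod 8056640625 ∷ 7464453124 mod 8201171875 ∷ 5940447497 mod 8394110595 ∷ []) ∷
  (5753515624 mod 8572265625 ∷ 2496709817 mod 8681088735 ∷ 6499999999 mod 8759765625 ∷ []) ∷
  (2377578124 mod 8993359375 ∷ 5263671874 mod 9130859375 ∷ 1396484374 mod 9345703125 ∷ []) ∷
  (7830078124 mod 9462890625 ∷ 9254609374 mod 9715234375 ∷ 1451171874 mod 9775390625 ∷ []) ∷
  (8132421874 mod 10130859375 ∷ 5800781249 mod 10205078125 ∷ 4089438494 mod 10259468505 ∷ []) ∷
  (7802734374 mod 10791015625 ∷ 4081859374 mod 10825546875 ∷ 8574218749 mod 11279296875 ∷ []) ∷
  (11611328124 mod 12060546875 ∷ 2569531249 mod 12263671875 ∷ 11162109374 mod 12353515625 ∷ []) ∷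
  (8142578124 mod 12783203125 ∷ 6586148312 mod 12784876137 ∷ 2677343749 mod 13248046875 ∷ []) ∷
  (3447265624 mod 13330078125 ∷ 4979906249 mod 13372734375 ∷ 7877549942 mod 13416228045 ∷ []) ∷
  (11701012058 mod 13637071305 ∷ 146093749 mod 14244140625 ∷ 3738281249 mod 14287109375 ∷ []) ∷
  (5205078124 mod 14599609375 ∷ 6973568801 mod 15109399071 ∷ 12890624999 mod 15576171875 ∷ []) ∷
  (6284821265 mod 15625959723 ∷ 15029296874 mod 15771484375 ∷ 1821874999 mod 15919921875 ∷ []) ∷
  (10377885517 mod 16302268983 ∷ 10574218749 mod 16884765625 ∷ 6607421874 mod 17294921875 ∷ []) ∷
  (3945312499 mod 17431640625 ∷ 1893890624 mod 17487421875 ∷ 13085937499 mod 17724609375 ∷ []) ∷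
  (1988593749 mod 18042578125 ∷ 8006690105 mod 18467043309 ∷ 16316636192 mod 19091899827 ∷ []) ∷
  (7673046874 mod 19271484375 ∷ 13759765624 mod 19482421875 ∷ 11622614669 mod 19758444939 ∷ []) ∷
  (1041015624 mod 20439453125 ∷ 17226171874 mod 20818359375 ∷ 12236328124 mod 20947265625 ∷ []) ∷
  (1953124999 mod 21240234375 ∷ 10718633528 mod 21308126895 ∷ 17068359374 mod 22080078125 ∷ []) ∷
  (19541328124 mod 22287890625 ∷ 6962890624 mod 23583984375 ∷ 20818359374 mod 23740234375 ∷ []) ∷
  (6457008149 mod 24149210481 ∷ 10804296874 mod 24603515625 ∷ 14205417929 mod 25182331785 ∷ []) ∷
  (11966988437 mod 26043266205 ∷ 25007812499 mod 26533203125 ∷ 14931640624 mod 27392578125 ∷ []) ∷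
  (17826874999 mod 29145703125 ∷ 2955078124 mod 29326171875 ∷ 6103515624 mod 29541015625 ∷ []) ∷
  (3652343749 mod 30615234375 ∷ 7896484374 mod 32119140625 ∷ 26064453124 mod 32373046875 ∷ []) ∷
  (11298890624 mod 32476640625 ∷ 4490234374 mod 34697265625 ∷ 5117187499 mod 36181640625 ∷ []) ∷
  (957031249 mod 37060546875 ∷ 23198828124 mod 37146484375 ∷ 14158203124 mod 38349609375 ∷ []) ∷
  [])

table₈ : List (ℕ × ℕ)
table₈ = concat (
  (15625959722 mod 40248684135 ∷ 30427734374 mod 41005859375 ∷ 38328124999 mod 42861328125 ∷ []) ∷
  (43291015624 mod 43798828125 ∷ 18565624999 mod 44966796875 ∷ 42968749999 mod 46728515625 ∷ []) ∷
  (43789062499 mod 47314453125 ∷ 40343359374 mod 48576171875 ∷ 44462890624 mod 48876953125 ∷ []) ∷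
  (4080078124 mod 50654296875 ∷ 43053828124 mod 54127734375 ∷ 2324522933 mod 55401129927 ∷ []) ∷
  (9927734374 mod 61318359375 ∷ 43935546874 mod 63916015625 ∷ 39129469388 mod 63924380685 ∷ []) ∷
  (7976562499 mod 66240234375 ∷ 62820312499 mod 71220703125 ∷ 38027343749 mod 71435546875 ∷ []) ∷
  (51914345525 mod 72447631443 ∷ 30993639119 mod 75546995355 ∷ 55322265624 mod 77880859375 ∷ []) ∷
  (75891369122 mod 78129798615 ∷ 20925781249 mod 79599609375 ∷ 57851562499 mod 84423828125 ∷ []) ∷
  (65410156249 mod 86474609375 ∷ 75927734374 mod 88623046875 ∷ 70550390624 mod 90212890625 ∷ []) ∷
  (69341796874 mod 96357421875 ∷ 35642684987 mod 98792224695 ∷ 99150390624 mod 102197265625 ∷ []) ∷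
  (96335937499 mod 104091796875 ∷ 109804687499 mod 110400390625 ∷ []) ∷
  (77489843749 mod 111439453125 ∷ 49306640624 mod 118701171875 ∷ []) ∷
  (29831377652 mod 120746052405 ∷ 74773437499 mod 123017578125 ∷ []) ∷
  (14394531249 mod 132666015625 ∷ 339453124 mod 145728515625 ∷ 55742187499 mod 146630859375 ∷ []) ∷
  (155644531249 mod 160595703125 ∷ 66248903618 mod 166203389781 ∷ []) ∷
  (53066406249 mod 173486328125 ∷ 15769531249 mod 185732421875 ∷ []) ∷
  (190566406249 mod 191748046875 ∷ 104238281249 mod 205029296875 ∷ []) ∷
  (158339843749 mod 214306640625 ∷ 98792224694 mod 217342894329 ∷ []) ∷
  (189439453124 mod 224833984375 ∷ 125146484374 mod 233642578125 ∷ []) ∷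
  (1482421874 mod 242880859375 ∷ 135781249999 mod 253271484375 ∷ []) ∷
  (237913671874 mod 270638671875 ∷ 269902940669 mod 277005649635 ∷ []) ∷
  (108037109374 mod 306591796875 ∷ 233193359374 mod 331201171875 ∷ []) ∷
  (304970703124 mod 356103515625 ∷ 116445312499 mod 397998046875 ∷ []) ∷
  (52507812499 mod 451064453125 ∷ 281328124999 mod 481787109375 ∷ []) ∷
  (491884765624 mod 520458984375 ∷ 144353515624 mod 557197265625 ∷ []) ∷
  (394619140624 mod 615087890625 ∷ 58630859374 mod 728642578125 ∷ []) ∷
  (362238157214 mod 831016948905 ∷ 350087890624 mod 928662109375 ∷ []) ∷
  (221604519707 mod 1086714471645 ∷ 818974609374 mod 1124169921875 ∷ []) ∷
  (778701171874 mod 1214404296875 ∷ 670935546874 mod 1353193359375 ∷ []) ∷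
  (2217617187499 mod 2255322265625 ∷ 2707460937499 mod 2785986328125 ∷ []) ∷
  -- The two largest moduli are 5^11 * 3 * 7 * 11 * 17 * 19 and 5^11 * 3 * 11 * 13 * 17 * 19: deep
  -- levels of a chain still call for products with several of the larger primes.
  (350087890624 mod 3643212890625 ∷ 1482851562499 mod 6765966796875 ∷ []) ∷
  [])

-- The system and its properties

table : List (ℕ × ℕ)
table = concat (
  table₀ ∷ table₁ ∷ table₂ ∷ table₃ ∷ table₄ ∷ table₅ ∷ table₆ ∷ table₇ ∷ table₈ ∷ [])

system : List Congruence
system = map toCongruence table

theorem4p2 : Σ (List Congruence) λ S →
    CoveringSystem S × All OddAboveOne (moduli S) × ElevenSevenTimesOthersDistinct S
-- 40 bounds the number of successive splits on a branch; being only a depth limit, it may be any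
-- number that lets the search succeed.
theorem4p2 = system , covering 40 table refl , decided (all? oddAboveOne? (moduli system)) refl ,
  -- The count of the modulus 11 is a computation. With 11 removed, the table is strictly
  -- increasing, which is the reason for ordering it by modulus.
  refl , ascending⇒unique (decided (linked? _<?_ (filter (λ m → ¬? (m ≟ 11)) (moduli system))) refl)
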